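{- Let $\mathbb{F}$ be a field and let $M$ be an acyclic matrix over $\mathbb{F}$ with zero diagonal, i.e. $M\in\mathcal{M}_{\mathbb{F},0}(F)$ for some forest $F$. The following procedure outputs a sparsest basis $\mathcal{B}_M$ of $\mathrm{Null}(M)$: (1) input $M$; (2) find the forest $F$ such that $M\in\mathcal{M}_{\mathbb{F},0}(F)$; (3) using the known algorithms for forests described in the context, find a sparsest basis $\mathcal{B}_F$ of $\mathrm{Null}(A(F))$ and the null support $\mathrm{Supp}(A(F))$; (4) find the connected components of $F$; (5) for each connected component $T_i$ of $F$ with $\mathrm{Supp}(A(T_i))\neq\emptyset$ choose a vertex $v_i\in\mathrm{Supp}(A(T_i))$; (6) let $U$ be the set of the chosen $v_i$ and calculate $(D^{(M,U)})^{ -1}$; (7) calculate $\mathcal{B}_M=(D^{(M,U)})^{ -1}\mathcal{B}_F=\{(D^{(M,U)})^{ -1}\vec{b}:\vec{b}\in\mathcal{B}_F\}$; (8) output $\mathcal{B}_M$. In particular, a sparsest basis of $\mathrm{Null}(A(F))$ yields a sparsest basis of $\mathrm{Null}(M)$ once it is multiplied by $(D^{(M,U)})^{ -1}$, and a sparsest basis of $\mathrm{Null}(M)$ can be found in optimal time.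
   Context: All graphs are finite, undirected, without loops or multiple edges. $\mathbb{F}$ is an arbitrary field. For a graph $G$, $\mathcal{M}_{\mathbb{F},0}(G)$ is the set of all (not necessarily symmetric) matrices $M$ over $\mathbb{F}$ with rows and columns indexed by $V(G)$, with all diagonal entries zero, and such that for distinct $u,w\in V(G)$ the entry $M_{u,w}$ is nonzero if and only if $\{u,w\}\in E(G)$. $A(G)$ is the adjacency matrix of $G$, viewed as a $(0,1)$-matrix over $\mathbb{F}$. $\mathrm{Null}(M)$ is the null space of $M$. The null support $\mathrm{Supp}(M)$ is the set of vertices $w\in V(G)$ such that some $\vec{x}\in\mathrm{Null}(M)$ has $\vec{x}_w\neq 0$. A sparsest basis of a subspace is a basis with the fewest nonzero entries. For vertices $v,w$ in the same connected component of a forest $F$, $vPw$ denotes the unique directed path from $v$ to $w$; $(a,b)\in vPw$ means that $a,b$ are consecutive vertices of this path with $a$ preceding $b$. For $M\in\mathcal{M}_{\mathbb{F},0}(F)$ and $v\in V(F)$, $D^{(M,v)}$ is the non-singular diagonal matrix with $$D^{(M,v)}_{w,w}=\prod_{\substack{u\in\mathrm{Supp}(M)\\ (u,t)\in vPw}}M_{u,t}^{ -1}\ \prod_{\substack{u\in\mathrm{Supp}(M)\\ (t,u)\in vPw}}M_{t,u}$$ for $w$ in the same component as $v$ (empty products equal $1$), and $D^{(M,v)}_{w,w}=1$ if $v$ and $w$ lie in different components. For a set $U\subset V(F)$ with at most one vertex in each connected component of $F$, $D^{(M,U)}$ is the non-singular diagonal matrix with $D^{(M,U)}_{w,w}=\prod_{v\in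 U}D^{(M,v)}_{w,w}$. The known algorithms for forests referred to in step (3) find the null support of the adjacency matrix of a forest in linear time, and a sparsest basis of its null space, with entries in $\{ -1,0,1\}$, in optimal time.
   Formalization: In D^{(M,v)} the inverted factor is M_{t,u}^{ -1}, not M_{u,t}^{ -1} (the literal formula fails for non-symmetric M); equality in the field is decidable; optimal time means a step count linear in the size of sparse input plus output, with no lower bound stated. -}

module Defs where

open import Level using (Level; _⊔_) renaming (suc to lsuc; zero to lzero)
open import Algebra.Bundles using (CommutativeRing)
import Algebra.Properties.CommutativeMonoid.Sum as MonoidSum
import Algebra.Properties.Ring as RingProperties
import Algebra.Properties.Semiring.Sum as SemiringSum
open import Data.Bool using (Bool; true; false; if_then_else_)
open import Data.Fin using (Fin; zero; suc)
open import Data.Fin.Properties using (_≟_; any?; all?)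
open import Data.Fin.Subset using (Subset; inside; outside; ∣_∣; _∈_; _∉_; _─_; _-_; ⊤)
open import Data.Fin.Subset.Properties
  using (_∈?_; ∈⊤; ∣⊤∣≡n; p─q⊆p; x∈p∧x≢y⇒x∈p-y; x∈p⇒∣p-x∣<∣p∣; x∈⁅x⁆)
open import Data.List using (List; []; _∷_; map; filter; allFin; length; lookup)
open import Data.List.Relation.Unary.All as All using (All; []; _∷_)
open import Data.List.Relation.Unary.Unique.Propositional using (Unique; []; _∷_)
open import Data.List.Membership.Propositional using () renaming (_∈_ to _∈ˡ_)
open import Data.Maybe using (Maybe; just; nothing; maybe)
open import Data.Nat as ℕ using (ℕ; zero; suc; _≤_; _<_; z≤n; s≤s)
import Data.Nat.Properties as ℕₚ
open import Data.Product using (Σ; ∃; _×_; _,_; proj₁; proj₂)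
open import Data.Sum using (_⊎_)
open import Data.Vec as Vec using (Vec; []; _∷_; here; there)
open import Data.Vec.Functional using (Vector)
open import Function using (_∘_)
open import Function.Bundles using (_⇔_)
open import Relation.Binary using (Rel; Decidable; Symmetric; Irreflexive)
open import Relation.Binary.PropositionalEquality as ≡ using (_≡_; _≢_)
open import Relation.Nullary using (¬_; Dec; yes; no; does; contradiction; ¬?)
open import Relation.Nullary.Decidable using (_×-dec_; map′)
import Relation.Binary.Reasoning.Setoid as SetoidReasoning

-- A field in the classical sense.  Decidability of equality is the
-- instance of excluded middle that the theory of matrix rank and null
-- supports relies on.  The value of 0# ⁻¹ is irrelevant.

record Field c ℓ : Set (lsuc (c ⊔ ℓ)) where
  field
    commutativeRing : CommutativeRing c ℓ

  open CommutativeRing commutativeRing public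

  infix 4 _≈?_
  infix 9 _⁻¹

  field
    _≈?_       : Decidable _≈_
    1≉0        : ¬ (1# ≈ 0#)
    _⁻¹        : Carrier → Carrier
    ⁻¹-inverse : ∀ x → ¬ (x ≈ 0#) → x * x ⁻¹ ≈ 1#

record Graph (n : ℕ) : Set₁ where
  infix 4 _~_ _~?_
  field
    _~_    : Rel (Fin n) lzero
    _~?_   : Decidable _~_
    symm   : Symmetric _~_
    irrefl : Irreflexive _≡_ _~_

module _ {n : ℕ} (G : Graph n) where
  open Graph G

  data Walk : Fin n → Fin n → Set where
    []  : ∀ {u} → Walk u u
    _∷_ : ∀ {u t w} → u ~ t → Walk t w → Walk u w

  vertices : ∀ {u w} → Walk u w → List (Fin n)
  vertices {u} []      = u ∷ []
  vertices {u} (_ ∷ p) = u ∷ vertices p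

  edgeCount : ∀ {u w} → Walk u w → ℕ
  edgeCount []      = 0
  edgeCount (_ ∷ p) = suc (edgeCount p)

  Path : Fin n → Fin n → Set
  Path u w = Σ (Walk u w) (Unique ∘ vertices)

  Connected : Fin n → Fin n → Set
  Connected = Walk

  -- A cycle is a path with at least two edges together with an edge
  -- joining its two ends.

  IsForest : Set
  IsForest = ∀ {u w} (p : Path u w) → 2 ≤ edgeCount (proj₁ p) → ¬ (w ~ u)

  private
    PathIn : Subset n → Fin n → Fin n → Set
    PathIn S u w = Σ (Path u w) λ p → All (_∈ S) (vertices (proj₁ p))

    head∈ : ∀ {S u w} (p : Walk u w) → All (_∈ S) (vertices p) → u ∈ S
    head∈ []      (u∈S ∷ _) = u∈S
    head∈ (_ ∷ _) (u∈S ∷ _) = u∈S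

    ∈─⇒∉ : ∀ {m} {x : Fin m} (p q : Subset m) → x ∈ p ─ q → x ∉ q
    ∈─⇒∉ (_ ∷ p) (outside ∷ q) (there x∈) (there x∈q) = ∈─⇒∉ p q x∈ x∈q
    ∈─⇒∉ (_ ∷ p) (inside  ∷ q) (there x∈) (there x∈q) = ∈─⇒∉ p q x∈ x∈q

    ∈-⇒≢ : ∀ {S : Subset n} {u v} → v ∈ S - u → u ≢ v
    ∈-⇒≢ {S} {u} v∈ ≡.refl = ∈─⇒∉ S _ v∈ (x∈⁅x⁆ u)

    pathIn? : ∀ k S → ∣ S ∣ ≤ k → ∀ u w → Dec (PathIn S u w)
    pathIn? k S ∣S∣≤k u w with u ∈? S
    pathIn? k S ∣S∣≤k u w | no u∉S = no λ { ((p , _) , p⊆S) → u∉S (head∈ p p⊆S) }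
    pathIn? k S ∣S∣≤k u w | yes u∈S with u ≟ w
    pathIn? k S ∣S∣≤k u .u | yes u∈S | yes ≡.refl = yes (([] , [] ∷ []) , u∈S ∷ [])
    pathIn? zero S ∣S∣≤k u w | yes u∈S | no u≢w =
      contradiction (ℕₚ.≤-trans (x∈p⇒∣p-x∣<∣p∣ u∈S) ∣S∣≤k) λ ()
    pathIn? (suc k) S ∣S∣≤k u w | yes u∈S | no u≢w =
      map′ extend restrict (any? λ t → u ~? t ×-dec pathIn? k (S - u) S-u≤k t w)
      where
      S-u≤k : ∣ S - u ∣ ≤ k
      S-u≤k = ℕₚ.≤-pred (ℕₚ.≤-trans (x∈p⇒∣p-x∣<∣p∣ u∈S) ∣S∣≤k)

      extend : ∃ (λ t → u ~ t × PathIn (S - u) t w) → PathIn S u w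
      extend (t , e , (p , uniq) , p⊆) =
        (e ∷ p , All.map ∈-⇒≢ p⊆ ∷ uniq) , u∈S ∷ All.map (p─q⊆p S _) p⊆

      restrict : PathIn S u w → ∃ (λ t → u ~ t × PathIn (S - u) t w)
      restrict (([] , _) , _) = contradiction ≡.refl u≢w
      restrict ((_∷_ {t = t} e p , u≢p ∷ uniq) , _ ∷ p⊆S) =
        t , e , (p , uniq) ,
        All.zipWith (λ { (u≢v , v∈S) → x∈p∧x≢y⇒x∈p-y v∈S (u≢v ∘ ≡.sym) }) (u≢p , p⊆S)

  path? : ∀ u w → Dec (Path u w)
  path? u w = map′ proj₁ (λ p → p , All.tabulate λ _ → ∈⊤)
                (pathIn? n ⊤ (ℕₚ.≤-reflexive (∣⊤∣≡n n)) u w)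

module Linear {c ℓ} (K : Field c ℓ) where
  open Field K hiding (zero)
  open SemiringSum semiring using (sum)
  open MonoidSum *-commutativeMonoid using () renaming (sum to product)

  Vect : ℕ → Set c
  Vect n = Vector Carrier n

  Matrix : ℕ → Set c
  Matrix n = Fin n → Fin n → Carrier

  infixr 7 _*ᵥ_
  infix  4 _∈𝓜₀_

  _*ᵥ_ : ∀ {n} → Matrix n → Vect n → Vect n
  (M *ᵥ x) u = sum λ w → M u w * x w

  diag : ∀ {n} → Vect n → Matrix n
  diag d u w = if does (u ≟ w) then d u else 0#

  Identity : ∀ {n} → Matrix n
  Identity = diag λ _ → 1#

  IsInverse : ∀ {n} → Matrix n → Matrix n → Set ℓ
  IsInverse E D = (∀ u w → sum (λ t → E u t * D t w) ≈ Identity u w)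
                × (∀ u w → sum (λ t → D u t * E t w) ≈ Identity u w)

  -- 𝓜_{𝔽,0}(G).  Off the diagonal the condition says that M u w is
  -- nonzero iff u ~ w; on the diagonal, where u ~ u fails, that M u u is zero.

  _∈𝓜₀_ : ∀ {n} → Matrix n → Graph n → Set ℓ
  M ∈𝓜₀ G = (∀ u → M u u ≈ 0#)
           × (∀ u w → u ≢ w → (¬ (M u w ≈ 0#)) ⇔ (Graph._~_ G u w))

  A : ∀ {n} → Graph n → Matrix n
  A G u w = if does (Graph._~?_ G u w) then 1# else 0#

  Null : ∀ {n} → Matrix n → Vect n → Set ℓ
  Null M x = ∀ u → (M *ᵥ x) u ≈ 0#

  Supp : ∀ {n} → Matrix n → Fin n → Set (c ⊔ ℓ)
  Supp M w = ∃ λ x → Null M x × ¬ (x w ≈ 0#)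

  -- Null space and null support of the principal submatrix M[C].  Vectors
  -- indexed by C are encoded as vectors vanishing outside C.

  NullOn : ∀ {n} → (Fin n → Set) → Matrix n → Vect n → Set ℓ
  NullOn C M x = (∀ u → ¬ C u → x u ≈ 0#) × (∀ u → C u → (M *ᵥ x) u ≈ 0#)

  SuppOn : ∀ {n} → (Fin n → Set) → Matrix n → Fin n → Set (c ⊔ ℓ)
  SuppOn C M w = C w × ∃ λ x → NullOn C M x × ¬ (x w ≈ 0#)

  combination : ∀ {n k} → (Fin k → Carrier) → (Fin k → Vect n) → Vect n
  combination a b u = sum λ i → a i * b i u

  IsBasis : ∀ {n k} → (Vect n → Set ℓ) → (Fin k → Vect n) → Set (c ⊔ ℓ)
  IsBasis W b =
      (∀ i → W (b i))
    × (∀ a → (∀ u → combination a b u ≈ 0#) → ∀ i → a i ≈ 0#)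
    × (∀ x → W x → ∃ λ a → ∀ u → combination a b u ≈ x u)

  nnz : ∀ {n} → Vect n → ℕ
  nnz x = length (filter (λ u → ¬? (x u ≈? 0#)) (allFin _))

  nnzFamily : ∀ {n k} → (Fin k → Vect n) → ℕ
  nnzFamily b = MonoidSum.sum ℕₚ.+-0-commutativeMonoid (nnz ∘ b)

  IsSparsestBasis : ∀ {n k} → (Vect n → Set ℓ) → (Fin k → Vect n) → Set (c ⊔ ℓ)
  IsSparsestBasis {n} W b =
    IsBasis W b × (∀ {k′} (b′ : Fin k′ → Vect n) → IsBasis W b′ → nnzFamily b ≤ nnzFamily b′)

  -- Membership in the null support is decidable: adding the rows of M one
  -- at a time, we maintain a matrix P whose columns are annihilated by the
  -- rows met so far and which fixes every vector annihilated by them.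

  private
    module _ {n : ℕ} where
      open SemiringSum semiring
        using (sum-cong-≋; ∑-distrib-+; ∑-comm; *-distribˡ-sum; *-distribʳ-sum; sum-replicate-zero)
      open RingProperties ring using (-‿distribˡ-*; -‿distribʳ-*)
      open SetoidReasoning setoid

      infix 8 _·_
      _·_ : Vect n → Vect n → Carrier
      r · x = sum λ u → r u * x u

      column : Matrix n → Fin n → Vect n
      column P i u = P u i

      sum-zero : ∀ {m} {f : Fin m → Carrier} → (∀ i → f i ≈ 0#) → sum f ≈ 0#
      sum-zero {m} f≈0 = trans (sum-cong-≋ f≈0) (sum-replicate-zero m)

      sum-δ : ∀ {m} (i : Fin m) (x : Fin m → Carrier) →
              sum (λ j → (if does (i ≟ j) then 1# else 0#) * x j) ≈ x i
      sum-δ zero x = trans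
        (+-cong (*-identityˡ _) (sum-zero λ j → zeroˡ (x (suc j)))) (+-identityʳ (x zero))
      sum-δ (suc i) x = trans (+-cong (zeroˡ _) (sum-δ i (x ∘ suc))) (+-identityˡ _)

      record Projection (m : ℕ) (R : Fin m → Vect n) : Set (c ⊔ ℓ) where
        field
          P        : Matrix n
          sound    : ∀ t i → R t · column P i ≈ 0#
          complete : ∀ x → (∀ t → R t · x ≈ 0#) → ∀ u → (P *ᵥ x) u ≈ x u

      project : ∀ m (R : Fin m → Vect n) → Projection m R
      project zero R = record
        { P = Identity ; sound = λ () ; complete = λ x _ u → sum-δ u x }
      project (suc m) R with project m (R ∘ suc)
      ... | record { P = P ; sound = sound ; complete = complete }
        with any? (λ i → ¬? (R zero · column P i ≈? 0#))
      ... | no none = record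
        { P = P
        ; sound = λ { zero i → stable i ; (suc t) i → sound t i }
        ; complete = λ x Rx → complete x (Rx ∘ suc) }
        where
        stable : ∀ i → R zero · column P i ≈ 0#
        stable i with R zero · column P i ≈? 0#
        ... | yes p = p
        ... | no ¬p = contradiction (i , ¬p) none
      ... | yes (i₀ , r₀≉0) = record { P = P′ ; sound = sound′ ; complete = complete′ }
        where
        r : Fin n → Carrier
        r i = R zero · column P i

        q : Vect n
        q u = r i₀ ⁻¹ * P u i₀

        P′ : Matrix n
        P′ u i = P u i + - r i * q u

        ·-P′ : ∀ (s : Vect n) i → s · column P′ i ≈ s · column P i + - r i * (r i₀ ⁻¹ * s · column P i₀)
        ·-P′ s i = begin
          sum (λ u → s u * (P u i + - r i * q u))
            ≈⟨ sum-cong-≋ (λ u → trans (distribˡ _ _ _) (+-congˡ (move (s u) (P u i₀)))) ⟩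
          sum (λ u → s u * P u i + - r i * (r i₀ ⁻¹ * (s u * P u i₀)))
            ≈⟨ ∑-distrib-+ (λ u → s u * P u i) _ ⟩
          s · column P i + sum (λ u → - r i * (r i₀ ⁻¹ * (s u * P u i₀)))
            ≈⟨ +-congˡ (sym (*-distribˡ-sum (- r i) (λ u → r i₀ ⁻¹ * (s u * P u i₀)))) ⟩
          s · column P i + - r i * sum (λ u → r i₀ ⁻¹ * (s u * P u i₀))
            ≈⟨ +-congˡ (*-congˡ (sym (*-distribˡ-sum (r i₀ ⁻¹) (λ u → s u * P u i₀)))) ⟩
          s · column P i + - r i * (r i₀ ⁻¹ * s · column P i₀) ∎
          where
          swap : ∀ x y z → x * (y * z) ≈ y * (x * z)
          swap x y z = trans (sym (*-assoc x y z)) (trans (*-congʳ (*-comm x y)) (*-assoc y x z))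

          move : ∀ x y → x * (- r i * (r i₀ ⁻¹ * y)) ≈ - r i * (r i₀ ⁻¹ * (x * y))
          move x y = trans (swap x _ _) (*-congˡ (swap x _ _))

        sound′ : ∀ t i → R t · column P′ i ≈ 0#
        sound′ zero i = begin
          R zero · column P′ i              ≈⟨ ·-P′ (R zero) i ⟩
          r i + - r i * (r i₀ ⁻¹ * r i₀)    ≈⟨ +-congˡ (*-congˡ (trans (*-comm _ _) (⁻¹-inverse _ r₀≉0))) ⟩
          r i + - r i * 1#                  ≈⟨ +-congˡ (*-identityʳ _) ⟩
          r i + - r i                       ≈⟨ -‿inverseʳ _ ⟩
          0# ∎
        sound′ (suc t) i = begin
          R (suc t) · column P′ i                             ≈⟨ ·-P′ (R (suc t)) i ⟩
          R (suc t) · column P i + - r i * (r i₀ ⁻¹ * R (suc t) · column P i₀)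
            ≈⟨ +-cong (sound t i) (*-congˡ (*-congˡ (sound t i₀))) ⟩
          0# + - r i * (r i₀ ⁻¹ * 0#)                         ≈⟨ +-identityˡ _ ⟩
          - r i * (r i₀ ⁻¹ * 0#)                              ≈⟨ *-congˡ (zeroʳ _) ⟩
          - r i * 0#                                          ≈⟨ zeroʳ _ ⟩
          0# ∎

        r·x : ∀ x → sum (λ i → r i * x i) ≈ R zero · (P *ᵥ x)
        r·x x = begin
          sum (λ i → sum (λ u → R zero u * P u i) * x i)
            ≈⟨ sum-cong-≋ (λ i → *-distribʳ-sum (x i) (λ u → R zero u * P u i)) ⟩
          sum (λ i → sum (λ u → R zero u * P u i * x i))
            ≈⟨ ∑-comm (λ i u → R zero u * P u i * x i) ⟩
          sum (λ u → sum (λ i → R zero u * P u i * x i))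
            ≈⟨ sum-cong-≋ (λ u → trans (sum-cong-≋ λ i → *-assoc (R zero u) (P u i) (x i))
                                          (sym (*-distribˡ-sum (R zero u) (λ i → P u i * x i)))) ⟩
          R zero · (P *ᵥ x) ∎

        complete′ : ∀ x → (∀ t → R t · x ≈ 0#) → ∀ u → (P′ *ᵥ x) u ≈ x u
        complete′ x Rx u = begin
          sum (λ i → (P u i + - r i * q u) * x i)
            ≈⟨ sum-cong-≋ (λ i → trans (distribʳ _ _ _) (+-congˡ (move i))) ⟩
          sum (λ i → P u i * x i + - q u * (r i * x i))
            ≈⟨ ∑-distrib-+ (λ i → P u i * x i) _ ⟩
          (P *ᵥ x) u + sum (λ i → - q u * (r i * x i))
            ≈⟨ +-cong (complete x (Rx ∘ suc) u) (sym (*-distribˡ-sum (- q u) (λ i → r i * x i))) ⟩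
          x u + - q u * sum (λ i → r i * x i)
            ≈⟨ +-congˡ (*-congˡ (trans (r·x x) (trans (sum-cong-≋ λ v → *-congˡ (complete x (Rx ∘ suc) v)) (Rx zero)))) ⟩
          x u + - q u * 0#
            ≈⟨ trans (+-congˡ (zeroʳ _)) (+-identityʳ _) ⟩
          x u ∎
          where
          move : ∀ i → - r i * q u * x i ≈ - q u * (r i * x i)
          move i = begin
            - r i * q u * x i     ≈⟨ *-congʳ (sym (-‿distribˡ-* _ _)) ⟩
            - (r i * q u) * x i   ≈⟨ *-congʳ (-‿cong (*-comm _ _)) ⟩
            - (q u * r i) * x i   ≈⟨ *-congʳ (-‿distribˡ-* _ _) ⟩
            - q u * r i * x i     ≈⟨ *-assoc _ _ _ ⟩
            - q u * (r i * x i)   ∎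

  supp? : ∀ {n} (M : Matrix n) w → Dec (Supp M w)
  supp? {n} M w with project n M
  ... | record { P = P ; sound = sound ; complete = complete }
    with any? (λ i → ¬? (P w i ≈? 0#))
  ... | yes (i , Pwi≉0) = yes (column P i , (λ u → sound u i) , Pwi≉0)
  ... | no none = no λ { (x , Mx≈0 , xw≉0) → xw≉0
          (trans (sym (complete x Mx≈0 w)) (sum-zero {n} λ i → trans (*-congʳ (stable i)) (zeroˡ _))) }
    where
    stable : ∀ i → P w i ≈ 0#
    stable i with P w i ≈? 0#
    ... | yes p = p
    ... | no ¬p = contradiction (i , ¬p) none

  module _ {n : ℕ} (G : Graph n) (M : Matrix n) where

    -- The contribution of (u , t) ∈ vPw when u is in the null support.
    -- The inverted entry is the one in row t and column u, as in `entering`: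
    -- D⁻¹ has to cancel the coefficient of the unknown x u in the equation
    -- of row t.  Inverting M u t instead gives the same matrix for symmetric
    -- M, but for the path on vertices 0, 1, 2 with M₁₂ = M₂₁ = 1, M₁₀ = 1
    -- and M₀₁ = a it turns (1, 0, -1) into (1, 0, -a), whereas Null(M) is
    -- spanned by (1, 0, -1).

    leaving : Fin n → Fin n → Carrier
    leaving u t = if does (supp? M u) then M t u ⁻¹ else 1#

    entering : Fin n → Fin n → Carrier
    entering t u = if does (supp? M u) then M t u else 1#

    pathProduct : ∀ {v w} → Walk G v w → Carrier
    pathProduct []                        = 1#
    pathProduct (_∷_ {u = u} {t = t} _ p) = leaving u t * entering u t * pathProduct p

    Dᵛ-entry : Fin n → Vect n
    Dᵛ-entry v w with path? G v w
    ... | yes (p , _) = pathProduct p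
    ... | no _        = 1#

    Dᵁ-entry : Subset n → Vect n
    Dᵁ-entry U w = product λ v → if does (v ∈? U) then Dᵛ-entry v w else 1#

    Dᵁ : Subset n → Matrix n
    Dᵁ U = diag (Dᵁ-entry U)

    Dᵁ⁻¹ : Subset n → Matrix n
    Dᵁ⁻¹ U = diag λ w → Dᵁ-entry U w ⁻¹

  -- U consists of one vertex of Supp(A(T)) for every connected component T
  -- of G for which this set is nonempty.  A(T) is the principal submatrix of
  -- A(G) on the vertices of T, and T is given by any of its vertices.

  record IsChoice {n} (G : Graph n) (U : Subset n) : Set (c ⊔ ℓ) where
    field
      chosen : ∀ {v} → v ∈ U → SuppOn (Connected G v) (A G) v
      single : ∀ {v w} → v ∈ U → w ∈ U → Connected G v w → v ≡ w
      every  : ∀ v {w} → SuppOn (Connected G v) (A G) w → ∃ λ u → u ∈ U × Connected G v u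

infix 4 _⟫_

-- Running time.  Programs are written with the operations below; a list
-- is inspected one cell at a time, and every such step, array access,
-- comparison of indices and field operation has unit cost.
-- Array updates are only applied to arrays that are not used afterwards.

record Timed {a} (X : Set a) : Set a where
  constructor _⟫_
  field
    time  : ℕ
    value : X

open Timed public

module Cost where
  private variable
    a b : Level
    X : Set a
    Y : Set b
    n : ℕ

  infixl 1 _>>=_
  infix  9 _!_

  return : X → Timed X
  return x = 0 ⟫ x

  _>>=_ : Timed X → (X → Timed Y) → Timed Y
  m >>= f = (time m ℕ.+ time (f (value m))) ⟫ value (f (value m))

  tick : Timed X → Timed X
  tick m = suc (time m) ⟫ value m

  newArray : ∀ n → X → Timed (Vec X n)
  newArray n x = n ⟫ Vec.replicate n x

  indices : ∀ n → Timed (List (Fin n))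
  indices n = n ⟫ allFin n

  _!_ : Vec X n → Fin n → Timed X
  xs ! i = 1 ⟫ Vec.lookup xs i

  _[_]:=_ : Vec X n → Fin n → X → Timed (Vec X n)
  xs [ i ]:= x = 1 ⟫ (xs Vec.[ i ]≔ x)

  _==_ : Fin n → Fin n → Timed Bool
  i == j = 1 ⟫ does (i ≟ j)

  mapList : (X → Timed Y) → List X → Timed (List Y)
  mapList f []       = tick (return [])
  mapList f (x ∷ xs) = tick do
    y  ← f x
    ys ← mapList f xs
    return (y ∷ ys)

  mapArray : (X → Timed Y) → Vec X n → Timed (Vec Y n)
  mapArray f []       = tick (return [])
  mapArray f (x ∷ xs) = tick do
    y  ← f x
    ys ← mapArray f xs
    return (y ∷ ys)

AdjacencyLists : ℕ → Set
AdjacencyLists n = Vec (List (Fin n)) n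

IsAdjacencyListsOf : ∀ {n} → AdjacencyLists n → Graph n → Set
IsAdjacencyListsOf adj G = ∀ u →
  Unique (Vec.lookup adj u) × (∀ w → w ∈ˡ Vec.lookup adj u ⇔ (Graph._~_ G u w))

module Algorithm {c ℓ} (K : Field c ℓ) where
  open Field K hiding (zero)
  open Linear K
  open Cost

  SparseVect : ℕ → Set c
  SparseVect n = List (Fin n × Carrier)

  SparseMatrix : ℕ → Set c
  SparseMatrix n = Vec (SparseVect n) n

  ⟦_⟧ : ∀ {n} → SparseVect n → Vect n
  ⟦ [] ⟧          u = 0#
  ⟦ (w , a) ∷ s ⟧ u = if does (w ≟ u) then a else ⟦ s ⟧ u

  ⟦_⟧* : ∀ {n} (B : List (SparseVect n)) → Fin (length B) → Vect n
  ⟦ B ⟧* i = ⟦ lookup B i ⟧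

  IsReduced : ∀ {n} → SparseVect n → Set (c ⊔ ℓ)
  IsReduced s = Unique (map proj₁ s) × All (λ (_ , a) → ¬ (a ≈ 0#)) s

  IsSparseFormOf : ∀ {n} → SparseMatrix n → Matrix n → Set (c ⊔ ℓ)
  IsSparseFormOf rows M = ∀ u →
    IsReduced (Vec.lookup rows u) × (∀ w → ⟦ Vec.lookup rows u ⟧ w ≈ M u w)

  -- The known algorithms for forests, with running times bounded in terms of
  -- the number of vertices and the number of nonzero entries produced.  The
  -- 1 accounts for the empty forest.

  record MeetsSpec {n} (c₀ : ℕ) (F : Graph n)
                   (supp : Timed (Subset n)) (basis : Timed (List (SparseVect n)))
                   : Set (c ⊔ ℓ) where
    private
      B_F = ⟦ value basis ⟧*
    field
      supp-correct   : ∀ w → w ∈ value supp ⇔ Supp (A F) w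
      supp-time      : time supp ≤ c₀ ℕ.* (1 ℕ.+ n)
      basis-reduced  : All IsReduced (value basis)
      basis-sparsest : IsSparsestBasis (Null (A F)) B_F
      basis-entries  : ∀ i u → B_F i u ≈ - 1# ⊎ B_F i u ≈ 0# ⊎ B_F i u ≈ 1#
      basis-time     : time basis ≤ c₀ ℕ.* (1 ℕ.+ n ℕ.+ nnzFamily B_F)

  record ForestAlgorithms (c₀ : ℕ) : Set (c ⊔ ℓ ⊔ lsuc lzero) where
    field
      findSupp  : ∀ {n} → AdjacencyLists n → Timed (Subset n)
      findBasis : ∀ {n} → AdjacencyLists n → Timed (List (SparseVect n))
      meetsSpec : ∀ {n} (F : Graph n) → IsForest F →
                  (adj : AdjacencyLists n) → IsAdjacencyListsOf adj F →
                  MeetsSpec c₀ F (findSupp adj) (findBasis adj)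

  module _ {n : ℕ} where

    -- (u , t , M u t), directed away from the root of a traversal

    Edge : Set c
    Edge = Fin n × Fin n × Carrier

    findForest : SparseMatrix n → Timed (AdjacencyLists n)
    findForest = mapArray (mapList λ (w , _) → return w)

    -- Depth-first traversal of the part of a tree that is reached from v
    -- without passing through its parent p; a root is its own parent.  The
    -- edges are listed in preorder, in front of the given list.  The first
    -- argument ensures termination: n exceeds the length of any path.

    explore  : ℕ → SparseMatrix n → (p v : Fin n) → List Edge → Timed (List Edge)
    branches : ℕ → SparseMatrix n → (p v : Fin n) → SparseVect n → List Edge → Timed (List Edge)

    explore zero    rows p v rest = tick (return rest)
    explore (suc k) rows p v rest = tick do
      row ← rows ! v
      branches k rows p v row rest

    branches k rows p v []              rest = tick (return rest)
    branches k rows p v ((t , a) ∷ row) rest = tick do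
      later  ← branches k rows p v row rest
      isBack ← t == p
      if isBack then return later else do
        below ← explore k rows v t later
        return ((v , t , a) ∷ below)

    traverse : SparseMatrix n → Fin n → Timed (List Edge)
    traverse rows v = explore n rows v v []

    markAll : List (Fin n) → Vec Bool n → Timed (Vec Bool n)
    markAll []       seen = tick (return seen)
    markAll (v ∷ vs) seen = tick do
      seen′ ← seen [ v ]:= true
      markAll vs seen′

    componentsFrom : SparseMatrix n → List (Fin n) → Vec Bool n → Timed (List (List (Fin n)))
    componentsFrom rows []       seen = tick (return [])
    componentsFrom rows (v ∷ vs) seen = tick do
      old ← seen ! v
      if old then componentsFrom rows vs seen else do
        edges ← traverse rows v
        below ← mapList (λ (_ , t , _) → return t) edges
        seen′ ← markAll (v ∷ below) seen
        Ts    ← componentsFrom rows vs seen′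
        return ((v ∷ below) ∷ Ts)

    components : SparseMatrix n → Timed (List (List (Fin n)))
    components rows = do
      vs   ← indices n
      seen ← newArray n false
      componentsFrom rows vs seen

    chooseIn : Subset n → List (Fin n) → Timed (Maybe (Fin n))
    chooseIn S []       = tick (return nothing)
    chooseIn S (v ∷ vs) = tick do
      v∈S ← S ! v
      if v∈S then return (just v) else chooseIn S vs

    choose : Subset n → List (List (Fin n)) → Timed (List (Fin n))
    choose S []       = tick (return [])
    choose S (T ∷ Ts) = tick do
      v  ← chooseIn S T
      vs ← choose S Ts
      return (maybe (_∷ vs) vs v)

    invert : Carrier → Timed Carrier
    invert x = 1 ⟫ x ⁻¹

    multiply : Carrier → Carrier → Timed Carrier
    multiply x y = 1 ⟫ (x * y)

    coefficient : SparseVect n → Fin n → Timed Carrier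
    coefficient []            u = tick (return 0#)
    coefficient ((w , a) ∷ s) u = tick do
      found ← w == u
      if found then return a else coefficient s u

    -- d t = d u · leaving u t · entering u t along the listed edges

    propagate : SparseMatrix n → Subset n → List Edge → Vec Carrier n → Timed (Vec Carrier n)
    propagate rows S []                  d = tick (return d)
    propagate rows S ((u , t , a) ∷ es) d = tick do
      dᵤ  ← d ! u
      u∈S ← S ! u
      x   ← if u∈S
              then (do row ← rows ! t
                       b   ← coefficient row u
                       b⁻¹ ← invert b
                       multiply dᵤ b⁻¹)
              else return dᵤ
      t∈S ← S ! t
      y   ← if t∈S then multiply x a else return x
      d′  ← d [ t ]:= y
      propagate rows S es d′

    propagateFrom : SparseMatrix n → Subset n → List (Fin n) → Vec Carrier n → Timed (Vec Carrier n)
    propagateFrom rows S []       d = tick (return d)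
    propagateFrom rows S (v ∷ vs) d = tick do
      edges ← traverse rows v
      d′    ← propagate rows S edges d
      propagateFrom rows S vs d′

    inverseDiagonal : SparseMatrix n → Subset n → List (Fin n) → Timed (Vec Carrier n)
    inverseDiagonal rows S U = do
      ones ← newArray n 1#
      d    ← propagateFrom rows S U ones
      mapArray invert d

    rescale : Vec Carrier n → List (SparseVect n) → Timed (List (SparseVect n))
    rescale e = mapList (mapList λ (u , a) → do
      eᵤ ← e ! u
      x  ← multiply eᵤ a
      return (u , x))

    procedure : ∀ {c₀} → ForestAlgorithms c₀ → SparseMatrix n → Timed (List (SparseVect n))
    procedure known rows = do
      adj ← findForest rows
      B_F ← findBasis adj
      S   ← findSupp adj
      Ts  ← components rows
      U   ← choose S Ts
      e   ← inverseDiagonal rows S U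
      rescale e B_F
      where open ForestAlgorithms known

-- With these the field is an explicit first argument.

open Linear public
open Algorithm public

-- In a forest, a value that is carried along walks and is restored by going
-- back and forth along an edge depends only on the ends of the walk.
--   Carrying scalings of rows and columns, one sees that two matrices of the
-- same forest are related by nonsingular diagonal matrices, so Supp(M) =
-- Supp(A(F)).  Carrying parities, one sees that no two vertices of the null
-- support are adjacent: if A x = 0 and u ~ t, restrict x to the even vertices
-- on the side of u; as A is symmetric, pairing the result with x gives
-- x u * x t = 0.
--   The entries D w of D^{(M,U)} are carried as well.  Independence of the
-- support gives M u t * (D t)⁻¹ = (D u)⁻¹ for every edge u t with t in the
-- support, so row u of M D⁻¹ x is (D u)⁻¹ times row u of A x whenever
-- A x = 0.  Thus D⁻¹ maps Null(A(F)) onto Null(M) and preserves the number of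
-- nonzero entries.
--   A depth-first traversal meets the vertices of a component once each, as
-- distinct neighbours of v are not joined by a walk avoiding v.  All running
-- times are therefore bounded by sums over distinct vertices of 1 + degree,
-- which is at most n + nnz(M).

module Submission where

open import Algebra.Bundles using (CommutativeMonoid)
import Algebra.Properties.CommutativeMonoid.Sum as MonoidSum
import Algebra.Properties.CommutativeSemigroup as CommutativeSemigroupProperties
import Algebra.Properties.Semiring.Sum as SemiringSum
open import Data.Bool using (Bool; true; false; if_then_else_; not; _∧_; _∨_; _xor_)
open import Data.Bool.Properties using (not-involutive; xor-assoc; xor-same; xor-identityʳ; ∨-comm; ∧-zeroʳ)
open import Data.Fin using (Fin; zero; suc; punchIn)
open import Data.Fin.Properties using (_≟_; any?; punchInᵢ≢i; subst-is-cast)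
open import Data.Fin.Subset using (Subset; _∈_)
open import Data.Fin.Subset.Properties using (_∈?_)
open import Data.List as List using (List; []; _∷_; _++_; map; length; allFin; tabulate; concatMap)
open import Data.List.Properties
  using (filter-≐; map-++; map-∘; map-tabulate; length-tabulate; length-map; ++-identityʳ; ++-assoc)
import Data.List.Membership.DecPropositional as DecMembership
open import Data.List.Membership.Propositional using (find; lose) renaming (_∈_ to _∈ˡ_; _∉_ to _∉ˡ_)
open import Data.List.Membership.Propositional.Properties
  using (∈-∃++; ∈-++⁺ˡ; ∈-++⁺ʳ; ∈-++⁻; ∈-map⁺; ∈-map⁻; ∈-allFin; ∈-filter⁺; ∈-filter⁻)
open import Data.List.Relation.Binary.Permutation.Propositional.Properties
  using (shift) renaming (map⁺ to ↭-map⁺)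
open import Data.List.Relation.Binary.Pointwise as Pointwise using (Pointwise; []; _∷_)
open import Data.List.Relation.Binary.Subset.Propositional using () renaming (_⊆_ to _⊆ˡ_)
open import Data.List.Relation.Unary.All as All using (All; []; _∷_)
open import Data.List.Relation.Unary.All.Properties
  using (¬Any⇒All¬; All¬⇒¬Any) renaming (map⁺ to All-map⁺)
open import Data.List.Relation.Unary.AllPairs as AllPairs using (AllPairs; []; _∷_)
import Data.List.Relation.Unary.AllPairs.Properties as AllPairsₚ
open import Data.List.Relation.Unary.Any as Any using (Any; here; there)
import Data.List.Relation.Unary.Any.Properties as Anyₚ
open import Data.List.Relation.Unary.Unique.Propositional using (Unique)
open import Data.List.Relation.Unary.Unique.Propositional.Properties using (++⁺; concat⁺; allFin⁺; filter⁺)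
open import Data.Maybe using (just; nothing)
open import Data.Nat as ℕ using (ℕ; zero; suc; _≤_; s≤s; z≤n)
import Data.Nat.ListAction as ListAction
open import Data.Nat.ListAction.Properties using (sum-++; sum-↭)
import Data.Nat.Properties as ℕₚ
open import Data.Nat.Tactic.RingSolver using (solve-∀)
open import Data.Product using (∃; ∃₂; _×_; _,_; proj₁; proj₂)
open import Data.Product.Relation.Binary.Pointwise.NonDependent using (×-setoid)
open import Data.Sum using (_⊎_; inj₁; inj₂)
open import Data.Unit using (⊤)
open import Data.Vec as Vec using (Vec; []; _∷_)
import Data.Vec.Properties as Vecₚ
open import Function using (_∘_; id)
open import Function.Bundles using (_⇔_; mk⇔; Equivalence)
open import Level using (_⊔_)
open import Relation.Binary using (Setoid)
open import Relation.Binary.PropositionalEquality as ≡ using (_≡_; _≢_)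
import Relation.Binary.Reasoning.Setoid as SetoidReasoning
open import Relation.Nullary using (¬_; Dec; yes; no; does; contradiction; ¬?)
open import Relation.Nullary.Decidable using (dec-true; dec-false; decidable-stable; _×-dec_; map′)
open import Defs
  using ( Field; module Field; Graph; module Graph; Walk; []; _∷_; vertices; edgeCount; Path; Connected
        ; IsForest; path?; module Linear; module Algorithm; module Cost; Timed; time; value
        ; AdjacencyLists; IsAdjacencyListsOf )

-- Acyclicity is applied at two places only: in `back-and-forth`, where a path closing an edge must
-- be that edge reversed, and in `branch-unique`, where two branches at a vertex cannot meet. The
-- single real obligation of a `Gauge` is `cancel`, and it dictates the form of what is carried. Row
-- and column scalings travel as a pair that is exchanged at every edge, because a row scaling at
-- one end determines a column scaling at the other. The factors of D cancel along an edge only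
-- because the inverted entry is M t u. Optimal time is read as linear in the size of input and
-- output: n + nnz(M) for the matrix, and the number of nonzero entries of the basis, which is least
-- possible since the basis is sparsest. Every step of the program therefore has to be charged to a
-- vertex, a matrix entry or a basis entry. The search of row t for the entry M t u is charged to t,
-- which is the target of at most one traversed edge; the overhead per basis vector is charged to
-- one of its entries, which exists because basis vectors are nonzero.

-- Walks in forests and transport along them.

module Forests {n : ℕ} (F : Graph n) where
  open Graph F
  open DecMembership (_≟_ {n}) using () renaming (_∈?_ to _∈ˡ?_)

  infixr 5 _++ʷ_

  _++ʷ_ : ∀ {u t w} → Walk F u t → Walk F t w → Walk F u w
  []      ++ʷ q = q
  (e ∷ p) ++ʷ q = e ∷ (p ++ʷ q)

  reverseʷ : ∀ {u w} → Walk F u w → Walk F w u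
  reverseʷ []      = []
  reverseʷ (e ∷ p) = reverseʷ p ++ʷ (symm e ∷ [])

  start∈ : ∀ {u w} (p : Walk F u w) → u ∈ˡ vertices F p
  start∈ []      = here ≡.refl
  start∈ (_ ∷ _) = here ≡.refl

  end∈ : ∀ {u w} (p : Walk F u w) → w ∈ˡ vertices F p
  end∈ []      = here ≡.refl
  end∈ (_ ∷ p) = there (end∈ p)

  split : ∀ {u w v} (p : Walk F u w) → v ∈ˡ vertices F p →
          ∃₂ λ (q : Walk F u v) (r : Walk F v w) → p ≡ q ++ʷ r
  split []      (here ≡.refl) = [] , [] , ≡.refl
  split (e ∷ p) (here ≡.refl) = [] , e ∷ p , ≡.refl
  split (e ∷ p) (there v∈p) with split p v∈p
  ... | q , r , ≡.refl = e ∷ q , r , ≡.refl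

  prefix⊆ : ∀ {u t w} (p : Walk F u t) (q : Walk F t w) → vertices F p ⊆ˡ vertices F (p ++ʷ q)
  prefix⊆ []      q (here ≡.refl) = start∈ q
  prefix⊆ (_ ∷ p) q (here ≡.refl) = here ≡.refl
  prefix⊆ (_ ∷ p) q (there v∈)    = there (prefix⊆ p q v∈)

  suffix⊆ : ∀ {u t w} (p : Walk F u t) (q : Walk F t w) → vertices F q ⊆ˡ vertices F (p ++ʷ q)
  suffix⊆ []      q = λ v∈ → v∈
  suffix⊆ (_ ∷ p) q = there ∘ suffix⊆ p q

  prefix-unique : ∀ {u t w} (p : Walk F u t) (q : Walk F t w) →
                  Unique (vertices F (p ++ʷ q)) → Unique (vertices F p)
  prefix-unique []      q _          = [] ∷ []
  prefix-unique (_ ∷ p) q (u∉ ∷ uniq) =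
    All.tabulate (All.lookup u∉ ∘ prefix⊆ p q) ∷ prefix-unique p q uniq

  suffix-unique : ∀ {u t w} (p : Walk F u t) (q : Walk F t w) →
                  Unique (vertices F (p ++ʷ q)) → Unique (vertices F q)
  suffix-unique []      q uniq       = uniq
  suffix-unique (_ ∷ p) q (_ ∷ uniq) = suffix-unique p q uniq

  length-vertices : ∀ {u w} (p : Walk F u w) → length (vertices F p) ≡ suc (edgeCount F p)
  length-vertices []      = ≡.refl
  length-vertices (_ ∷ p) = ≡.cong suc (length-vertices p)

  ∉-++ʷ : ∀ {u t w x} (p : Walk F u t) (q : Walk F t w) →
          x ∉ˡ vertices F p → x ∉ˡ vertices F q → x ∉ˡ vertices F (p ++ʷ q)
  ∉-++ʷ []      q _   x∉q x∈          = x∉q x∈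
  ∉-++ʷ (_ ∷ p) q x∉p x∉q (here eq)   = x∉p (here eq)
  ∉-++ʷ (_ ∷ p) q x∉p x∉q (there x∈)  = ∉-++ʷ p q (x∉p ∘ there) x∉q x∈

  reverse-∉ : ∀ {u w x} (p : Walk F u w) → x ∉ˡ vertices F p → x ∉ˡ vertices F (reverseʷ p)
  reverse-∉ []      x∉p = x∉p
  reverse-∉ (_ ∷ p) x∉p = ∉-++ʷ (reverseʷ p) _ (reverse-∉ p (x∉p ∘ there))
    λ { (here ≡.refl) → x∉p (there (start∈ p)) ; (there (here ≡.refl)) → x∉p (here ≡.refl) }

  -- A value to be carried along walks.  In a forest a walk shortens to a path
  -- by cancelling steps back and forth along an edge, so that the result of
  -- the transport depends on the two ends only.

  record Gauge {a b} (X : Setoid a b) : Set (a ⊔ b) where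
    open Setoid X
    field
      step    : ∀ {u t} → u ~ t → Carrier → Carrier
      cong    : ∀ {u t} (e : u ~ t) {x y} → x ≈ y → step e x ≈ step e y
      cancel  : ∀ {u t} (e : u ~ t) (e′ : t ~ u) x → step e′ (step e x) ≈ x

    transport : ∀ {u w} → Walk F u w → Carrier → Carrier
    transport []      x = x
    transport (e ∷ p) x = transport p (step e x)

    transport-cong : ∀ {u w} (p : Walk F u w) {x y} → x ≈ y → transport p x ≈ transport p y
    transport-cong []      x≈y = x≈y
    transport-cong (e ∷ p) x≈y = transport-cong p (cong e x≈y)

    transport-++ : ∀ {u t w} (p : Walk F u t) (q : Walk F t w) x →
                   transport (p ++ʷ q) x ≡ transport q (transport p x)
    transport-++ []      q x = ≡.refl
    transport-++ (e ∷ p) q x = transport-++ p q (step e x)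

  module _ (forest : IsForest F) where

    module _ {a b} {X : Setoid a b} (G : Gauge X) where
      open Setoid X
      open Gauge G

      private
        back-and-forth : ∀ {u t} (e : u ~ t) (q : Walk F t u) → Unique (vertices F q) →
                         ∀ x → transport q (step e x) ≈ x
        back-and-forth e []             _    x = contradiction e (irrefl ≡.refl)
        back-and-forth e (e′ ∷ [])      _    x = cancel e e′ x
        back-and-forth e p@(_ ∷ _ ∷ _) uniq x =
          contradiction e (forest (p , uniq) (s≤s (s≤s z≤n)))

      -- If u already lies on the shortened tail, the tail up to u is a path closing the edge e,
      -- hence e backwards, and both are dropped together. The inclusion of vertices serves
      -- arguments about walks that avoid a vertex.
      shorten : ∀ {u w} (p : Walk F u w) → ∃ λ (q : Path F u w) →
                vertices F (proj₁ q) ⊆ˡ vertices F p × (∀ x → transport p x ≈ transport (proj₁ q) x)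
      shorten []              = ([] , [] ∷ []) , id , λ _ → refl
      shorten (_∷_ {u} e p) with shorten p
      ... | (q , uniq) , q⊆p , p≈q with u ∈ˡ? vertices F q
      ... | no u∉q = (e ∷ q , ¬Any⇒All¬ _ u∉q ∷ uniq) , ⊆∷ , λ x → p≈q (step e x)
        where
        ⊆∷ : u ∷ vertices F q ⊆ˡ u ∷ vertices F p
        ⊆∷ (here eq)  = here eq
        ⊆∷ (there v∈) = there (q⊆p v∈)
      ... | yes u∈q with split q u∈q
      ... | q₁ , q₂ , ≡.refl = (q₂ , suffix-unique q₁ q₂ uniq) , there ∘ q⊆p ∘ suffix⊆ q₁ q₂ , λ x →
        trans (p≈q (step e x)) (trans (reflexive (transport-++ q₁ q₂ (step e x)))
          (transport-cong q₂ (back-and-forth e q₁ (prefix-unique q₁ q₂ uniq) x)))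

      loop : ∀ {u} (p : Walk F u u) x → transport p x ≈ x
      loop p x with shorten p
      ... | ([] , _)              , _ , p≈[] = p≈[] x
      ... | (_ ∷ q , u∉q ∷ _) , _ , _    = contradiction (end∈ q) (All¬⇒¬Any u∉q)

      -- Insert the reverse of q followed by q after p: the closed walk at the end of p acts
      -- trivially, and so does p followed by the reverse of q.
      transport-unique : ∀ {u w} (p q : Walk F u w) x → transport p x ≈ transport q x
      transport-unique p q x = trans
        (sym (trans (reflexive (≡.sym (transport-++ (reverseʷ q) q _))) (loop (reverseʷ q ++ʷ q) _)))
        (transport-cong q (trans (reflexive (≡.sym (transport-++ p (reverseʷ q) x)))
                                 (loop (p ++ʷ reverseʷ q) x)))

      -- Off the component of v the initial value is kept. With initial value 1 this is the
      -- convention for the entries of D^{(M,v)} in other components.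
      potential : Fin n → Carrier → Fin n → Carrier
      potential v x w with path? F v w
      ... | yes (p , _) = transport p x
      ... | no _        = x

      potential-walk : ∀ {v w} x (p : Walk F v w) → potential v x w ≈ transport p x
      potential-walk {v} {w} x p with path? F v w
      ... | yes (q , _) = transport-unique q p x
      ... | no ¬path    = contradiction (proj₁ (shorten p)) ¬path

      potential-off : ∀ {v w} x → ¬ Connected F v w → potential v x w ≡ x
      potential-off {v} {w} x ¬p with path? F v w
      ... | yes (p , _) = contradiction p ¬p
      ... | no _        = ≡.refl

      potential-step : ∀ {v u t} x → Connected F v u → (e : u ~ t) →
                       potential v x t ≈ step e (potential v x u)
      potential-step x p e = trans (potential-walk x (p ++ʷ (e ∷ []))) (trans
        (reflexive (transport-++ p (e ∷ []) x)) (cong e (sym (potential-walk x p))))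

    private
      -- Carries no information: it gives access to `shorten` when only the path is wanted.
      trivial : Gauge (≡.setoid ⊤)
      trivial = record { step = λ _ → id ; cong = λ _ → id ; cancel = λ _ _ _ → ≡.refl }

    toPath : ∀ {u w} → Walk F u w → Path F u w
    toPath p = proj₁ (shorten trivial p)

    connected? : ∀ u w → Dec (Connected F u w)
    connected? u w = map′ proj₁ toPath (path? F u w)

    -- Otherwise the walk, shortened to a path that still avoids v, would form a cycle with the two
    -- edges at v.
    branch-unique : ∀ {v t t′} → v ~ t → v ~ t′ → (p : Walk F t t′) → v ∉ˡ vertices F p → t ≡ t′
    branch-unique e e′ p v∉p with shorten trivial p
    ... | ([] , _) , _ = ≡.refl
    ... | (e₁ ∷ q , uniq) , q⊆p , _ = contradiction (symm e′)
      (forest (e ∷ e₁ ∷ q , ¬Any⇒All¬ _ (v∉p ∘ q⊆p) ∷ uniq) (s≤s (s≤s z≤n)))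

-- Inverses, sums with a single term, and diagonal scaling of bases.

module FieldProperties {c ℓ} (K : Field c ℓ) where
  open Field K renaming (zero to *-zero)
  open SetoidReasoning setoid

  ⁻¹-inverseˡ : ∀ {x} → ¬ (x ≈ 0#) → x ⁻¹ * x ≈ 1#
  ⁻¹-inverseˡ x≉0 = trans (*-comm _ _) (⁻¹-inverse _ x≉0)

  *-cancelˡ-0 : ∀ {x y} → ¬ (x ≈ 0#) → x * y ≈ 0# → y ≈ 0#
  *-cancelˡ-0 {x} {y} x≉0 xy≈0 = begin
    y               ≈⟨ *-identityˡ y ⟨
    1# * y          ≈⟨ *-congʳ (⁻¹-inverseˡ x≉0) ⟨
    x ⁻¹ * x * y    ≈⟨ *-assoc _ _ _ ⟩
    x ⁻¹ * (x * y)  ≈⟨ *-congˡ xy≈0 ⟩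
    x ⁻¹ * 0#       ≈⟨ zeroʳ _ ⟩
    0#              ∎

  *-nonzero : ∀ {x y} → ¬ (x ≈ 0#) → ¬ (y ≈ 0#) → ¬ (x * y ≈ 0#)
  *-nonzero x≉0 y≉0 = y≉0 ∘ *-cancelˡ-0 x≉0

  ⁻¹-nonzero : ∀ {x} → ¬ (x ≈ 0#) → ¬ (x ⁻¹ ≈ 0#)
  ⁻¹-nonzero {x} x≉0 x⁻¹≈0 =
    1≉0 (trans (sym (⁻¹-inverse x x≉0)) (trans (*-congˡ x⁻¹≈0) (zeroʳ x)))

  ⁻¹-unique : ∀ {x y} → x * y ≈ 1# → y ≈ x ⁻¹
  ⁻¹-unique {x} {y} xy≈1 = begin
    y               ≈⟨ *-identityʳ y ⟨
    y * 1#          ≈⟨ *-congˡ (⁻¹-inverse x x≉0) ⟨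
    y * (x * x ⁻¹)  ≈⟨ *-assoc _ _ _ ⟨
    y * x * x ⁻¹    ≈⟨ *-congʳ (trans (*-comm y x) xy≈1) ⟩
    1# * x ⁻¹       ≈⟨ *-identityˡ _ ⟩
    x ⁻¹            ∎
    where
    x≉0 : ¬ (x ≈ 0#)
    x≉0 x≈0 = 1≉0 (trans (sym xy≈1) (trans (*-congʳ x≈0) (zeroˡ y)))

  -- Congruence of inversion is not an axiom of `Field`; it comes from uniqueness of inverses, hence
  -- the restriction to nonzero arguments.
  ⁻¹-cong : ∀ {x y} → ¬ (x ≈ 0#) → x ≈ y → x ⁻¹ ≈ y ⁻¹
  ⁻¹-cong x≉0 x≈y = ⁻¹-unique (trans (*-congʳ (sym x≈y)) (⁻¹-inverse _ x≉0))

  *-cancel-mid : ∀ {x y z} → y * z ≈ 1# → x * y * z ≈ x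
  *-cancel-mid yz≈1 = trans (*-assoc _ _ _) (trans (*-congˡ yz≈1) (*-identityʳ _))

module SingleTerm {c ℓ} (M : CommutativeMonoid c ℓ) where
  open CommutativeMonoid M
  open MonoidSum M

  sum-trivial : ∀ {n} {f : Fin n → Carrier} → (∀ i → f i ≈ ε) → sum f ≈ ε
  sum-trivial {n} f≈ε = trans (sum-cong-≋ f≈ε) (sum-replicate-zero n)

  -- Stated for a commutative monoid because it serves both the sums in matrix products and the
  -- product over U in `Dᵁ-entry`.
  sum-single : ∀ {n} {f : Fin n → Carrier} i → (∀ j → j ≢ i → f j ≈ ε) → sum f ≈ f i
  sum-single {suc n} {f} i f≈ε = trans (sum-remove {i = i} f) (trans
    (∙-congˡ (sum-trivial λ j → f≈ε (punchIn i j) (punchInᵢ≢i i j))) (identityʳ (f i)))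

module LinearProperties {c ℓ} (K : Field c ℓ) where
  open Field K renaming (zero to *-zero)
  open Linear K
  open FieldProperties K
  open SemiringSum semiring using (sum; sum-cong-≋; *-distribˡ-sum)
  open SingleTerm +-commutativeMonoid public
  open CommutativeSemigroupProperties *-commutativeSemigroup using (x∙yz≈y∙xz)
  open SetoidReasoning setoid

  diag-diagonal : ∀ {n} (d : Vect n) u → diag d u u ≈ d u
  diag-diagonal d u rewrite dec-true (u ≟ u) ≡.refl = refl

  diag-off-diagonal : ∀ {n} (d : Vect n) {u w} → u ≢ w → diag d u w ≈ 0#
  diag-off-diagonal d {u} {w} u≢w rewrite dec-false (u ≟ w) u≢w = refl

  diag-*ᵥ : ∀ {n} (d x : Vect n) u → (diag d *ᵥ x) u ≈ d u * x u
  diag-*ᵥ d x u = trans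
    (sum-single u λ w w≢u → trans (*-congʳ (diag-off-diagonal d (w≢u ∘ ≡.sym))) (zeroˡ _))
    (*-congʳ (diag-diagonal d u))

  diag-product : ∀ {n} {d e : Vect n} → (∀ u → e u * d u ≈ 1#) →
                 ∀ u w → sum (λ t → diag e u t * diag d t w) ≈ Identity u w
  diag-product {d = d} {e} ed≈1 u w = trans (diag-*ᵥ e (λ t → diag d t w) u) entry
    where
    entry : e u * diag d u w ≈ Identity u w
    entry with u ≟ w
    ... | yes ≡.refl = ed≈1 u
    ... | no _       = zeroʳ (e u)

  diag-inverse : ∀ {n} {d e : Vect n} → (∀ u → e u * d u ≈ 1#) → IsInverse (diag e) (diag d)
  diag-inverse ed≈1 = diag-product ed≈1 , diag-product λ u → trans (*-comm _ _) (ed≈1 u)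

  nnz-cong : ∀ {n} {x y : Vect n} → (∀ u → x u ≈ 0# ⇔ y u ≈ 0#) → nnz x ≡ nnz y
  nnz-cong {x = x} {y} x⇔y = ≡.cong length (filter-≐
    (λ u → ¬? (x u ≈? 0#)) (λ u → ¬? (y u ≈? 0#))
    ( (λ {u} x≉0 → x≉0 ∘ Equivalence.from (x⇔y u))
    , (λ {u} y≉0 → y≉0 ∘ Equivalence.to (x⇔y u)) ) (allFin _))

  nnzFamily-cong : ∀ {n k} {b b′ : Fin k → Vect n} → (∀ i u → b i u ≈ 0# ⇔ b′ i u ≈ 0#) →
                   nnzFamily b ≡ nnzFamily b′
  nnzFamily-cong b⇔b′ =
    MonoidSum.sum-cong-≗ ℕₚ.+-0-commutativeMonoid λ i → nnz-cong (b⇔b′ i)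

  -- Without function extensionality the spaces need not respect pointwise
  -- equality of vectors, so the two hypotheses build it in.

  module _ {n : ℕ} {W W′ : Vect n → Set ℓ} {d e : Vect n} (ed≈1 : ∀ u → e u * d u ≈ 1#)
           (W→W′ : ∀ {x y} → W x → (∀ u → y u ≈ e u * x u) → W′ y)
           (W′→W : ∀ {x y} → W′ x → (∀ u → y u ≈ d u * x u) → W y)
           where

    private
      module _ {k : ℕ} {b b′ : Fin k → Vect n} (b′≈eb : ∀ i u → b′ i u ≈ e u * b i u) where

        combination-scale : ∀ a u → combination a b′ u ≈ e u * combination a b u
        combination-scale a u = trans
          (sum-cong-≋ λ i → trans (*-congˡ (b′≈eb i u)) (x∙yz≈y∙xz (a i) (e u) (b i u)))
          (sym (*-distribˡ-sum (e u) (λ i → a i * b i u)))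

        combination-unscale : ∀ a u → d u * combination a b′ u ≈ combination a b u
        combination-unscale a u = begin
          d u * combination a b′ u           ≈⟨ *-congˡ (combination-scale a u) ⟩
          d u * (e u * combination a b u)    ≈⟨ *-assoc _ _ _ ⟨
          d u * e u * combination a b u      ≈⟨ *-congʳ (trans (*-comm _ _) (ed≈1 u)) ⟩
          1# * combination a b u             ≈⟨ *-identityˡ _ ⟩
          combination a b u                  ∎

    scale-basis : ∀ {k} {b b′ : Fin k → Vect n} → (∀ i u → b′ i u ≈ e u * b i u) →
                  IsBasis W b → IsBasis W′ b′
    scale-basis {b = b} {b′} b′≈eb (b∈W , independent , spanning) =
        (λ i → W→W′ (b∈W i) (b′≈eb i))
      , (λ a ab′≈0 → independent a λ u → trans (sym (combination-unscale b′≈eb a u))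
          (trans (*-congˡ (ab′≈0 u)) (zeroʳ _)))
      , λ x x∈W′ → let a , ab≈dx = spanning _ (W′→W x∈W′ λ _ → refl) in
          a , λ u → begin
            combination a b′ u       ≈⟨ combination-scale b′≈eb a u ⟩
            e u * combination a b u  ≈⟨ *-congˡ (ab≈dx u) ⟩
            e u * (d u * x u)        ≈⟨ *-assoc _ _ _ ⟨
            e u * d u * x u          ≈⟨ *-congʳ (ed≈1 u) ⟩
            1# * x u                 ≈⟨ *-identityˡ _ ⟩
            x u                      ∎

  scale-nnz : ∀ {n k} {e : Vect n} {b b′ : Fin k → Vect n} → (∀ u → ¬ (e u ≈ 0#)) →
              (∀ i u → b′ i u ≈ e u * b i u) → nnzFamily b′ ≡ nnzFamily b
  scale-nnz e≉0 b′≈eb = nnzFamily-cong λ i u → mk⇔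
    (λ b′≈0 → *-cancelˡ-0 (e≉0 u) (trans (sym (b′≈eb i u)) b′≈0))
    (λ b≈0 → trans (b′≈eb i u) (trans (*-congˡ b≈0) (zeroʳ _)))

  -- Scaling by e carries bases of W to bases of W′ and scaling by d carries them back, both without
  -- changing the positions of zeros. A competitor in W′ is pulled back to W and compared there.
  scale-sparsest : ∀ {n k} {W W′ : Vect n → Set ℓ} {d e : Vect n} → (∀ u → e u * d u ≈ 1#) →
                   (∀ {x y} → W x → (∀ u → y u ≈ e u * x u) → W′ y) →
                   (∀ {x y} → W′ x → (∀ u → y u ≈ d u * x u) → W y) →
                   {b b′ : Fin k → Vect n} → (∀ i u → b′ i u ≈ e u * b i u) →
                   IsSparsestBasis W b → IsSparsestBasis W′ b′
  scale-sparsest {d = d} {e} ed≈1 W→W′ W′→W b′≈eb (basis , sparsest) =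
      scale-basis ed≈1 W→W′ W′→W b′≈eb basis
    , λ b″ basis″ → ≡.subst₂ _≤_ (≡.sym (scale-nnz e≉0 b′≈eb))
        (scale-nnz {b = b″} d≉0 λ _ _ → refl) (sparsest _ (scale-basis de≈1 W′→W W→W′ (λ _ _ → refl) basis″))
    where
    de≈1 : ∀ u → d u * e u ≈ 1#
    de≈1 u = trans (*-comm _ _) (ed≈1 u)

    e≉0 : ∀ u → ¬ (e u ≈ 0#)
    e≉0 u e≈0 = 1≉0 (trans (sym (ed≈1 u)) (trans (*-congʳ e≈0) (zeroˡ _)))

    d≉0 : ∀ u → ¬ (d u ≈ 0#)
    d≉0 u d≈0 = 1≉0 (trans (sym (de≈1 u)) (trans (*-congʳ d≈0) (zeroˡ _)))

-- Null supports of the matrices of a forest.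

module Supports {c ℓ} (K : Field c ℓ) {n : ℕ} (F : Graph n) (forest : IsForest F) where
  open Field K renaming (zero to *-zero)
  open Linear K
  open FieldProperties K
  open LinearProperties K
  open Graph F
  open Forests F
  open SemiringSum semiring using (sum; sum-cong-≋; *-distribˡ-sum; *-distribʳ-sum; ∑-comm; ∑-distrib-+)
  open CommutativeSemigroupProperties *-commutativeSemigroup using (x∙yz≈y∙xz; interchange)
  open SetoidReasoning setoid

  entry-nonzero : ∀ {M} → M ∈𝓜₀ F → ∀ {u w} → u ~ w → ¬ (M u w ≈ 0#)
  entry-nonzero (_ , off) e = Equivalence.from (off _ _ λ { ≡.refl → irrefl ≡.refl e }) e

  entry-zero : ∀ {M} → M ∈𝓜₀ F → ∀ {u w} → ¬ (u ~ w) → M u w ≈ 0#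
  entry-zero {M} (diagonal , off) {u} {w} ¬e with u ≟ w
  ... | yes ≡.refl = diagonal u
  ... | no u≢w     = decidable-stable (M u w ≈? 0#) (¬e ∘ Equivalence.to (off u w u≢w))

  A-edge : ∀ {u w} → u ~ w → A F u w ≈ 1#
  A-edge {u} {w} e rewrite dec-true (u ~? w) e = refl

  A-nonedge : ∀ {u w} → ¬ (u ~ w) → A F u w ≈ 0#
  A-nonedge {u} {w} ¬e rewrite dec-false (u ~? w) ¬e = refl

  A∈𝓜₀ : A F ∈𝓜₀ F
  A∈𝓜₀ = (λ u → A-nonedge (irrefl ≡.refl)) , λ u w _ → mk⇔
    (λ A≉0 → decidable-stable (u ~? w) (A≉0 ∘ A-nonedge))
    (λ e A≈0 → 1≉0 (trans (sym (A-edge e)) A≈0))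

  A-symmetric : ∀ u w → A F u w ≈ A F w u
  A-symmetric u w with u ~? w
  ... | yes e = sym (A-edge (symm e))
  ... | no ¬e = sym (A-nonedge (¬e ∘ symm))

  module _ {M N : Matrix n} (M∈ : M ∈𝓜₀ F) (N∈ : N ∈𝓜₀ F) where

    -- Terms at non-neighbours vanish on both sides, so it suffices to compare terms along the edges
    -- at u. The verifications that a constructed vector is null rest on this, apart from closure
    -- under addition.
    row-scale : ∀ {x y : Vect n} u h → (∀ {w} → u ~ w → M u w * y w ≈ h * (N u w * x w)) →
                (M *ᵥ y) u ≈ h * (N *ᵥ x) u
    row-scale {x} {y} u h edge = trans (sum-cong-≋ term) (sym (*-distribˡ-sum h λ w → N u w * x w))
      where
      term : ∀ w → M u w * y w ≈ h * (N u w * x w)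
      term w with u ~? w
      ... | yes e = edge e
      ... | no ¬e = trans (trans (*-congʳ (entry-zero M∈ ¬e)) (zeroˡ _))
        (sym (trans (*-congˡ (trans (*-congʳ (entry-zero N∈ ¬e)) (zeroˡ _))) (zeroʳ h)))

    row-null : ∀ {x y : Vect n} → Null N x → ∀ u h →
               (∀ {w} → u ~ w → M u w * y w ≈ h * (N u w * x w)) → (M *ᵥ y) u ≈ 0#
    row-null Nx≈0 u h edge = trans (row-scale u h edge) (trans (*-congˡ (Nx≈0 u)) (zeroʳ h))

  row-zero : ∀ {M} → M ∈𝓜₀ F → ∀ {y : Vect n} u → (∀ {w} → u ~ w → y w ≈ 0#) → (M *ᵥ y) u ≈ 0#
  row-zero M∈ {y} u y≈0 = trans
    (row-scale M∈ M∈ {x = y} u 0# λ e → trans (trans (*-congˡ (y≈0 e)) (zeroʳ _)) (sym (zeroˡ _)))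
    (zeroˡ _)

  module _ {M N : Matrix n} (M∈ : M ∈𝓜₀ F) (N∈ : N ∈𝓜₀ F) where

    private
      ratio-cancel : ∀ {L L′} → L ∈𝓜₀ F → L′ ∈𝓜₀ F → ∀ {u t} → u ~ t →
                     L u t * L′ u t ⁻¹ * (L′ u t * L u t ⁻¹) ≈ 1#
      ratio-cancel {L} {L′} L∈ L′∈ {u} {t} e = begin
        L u t * L′ u t ⁻¹ * (L′ u t * L u t ⁻¹)  ≈⟨ *-congˡ (*-comm _ _) ⟩
        L u t * L′ u t ⁻¹ * (L u t ⁻¹ * L′ u t)  ≈⟨ interchange _ _ _ _ ⟩
        L u t * L u t ⁻¹ * (L′ u t ⁻¹ * L′ u t)
          ≈⟨ *-cong (⁻¹-inverse _ (entry-nonzero L∈ e)) (⁻¹-inverseˡ (entry-nonzero L′∈ e)) ⟩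
        1# * 1#                                  ≈⟨ *-identityˡ 1# ⟩
        1#                                       ∎

      -- Scalings r of the rows and c of the columns with
      -- M u t * c t ≈ r u * N u t along the edges.

      equivalence : Gauge (×-setoid setoid setoid)
      equivalence = record
        { step   = λ {u} {t} _ (r , c) → c * (M t u * N t u ⁻¹) , r * (N u t * M u t ⁻¹)
        ; cong   = λ { _ (r≈ , c≈) → *-congʳ c≈ , *-congʳ r≈ }
        ; cancel = λ e e′ _ →
            *-cancel-mid (ratio-cancel N∈ M∈ e) , *-cancel-mid (ratio-cancel M∈ N∈ e′)
        }

    -- The column scalings, started with 1 at w, turn a null vector of N into one of M on the
    -- component of w, and the row scalings are the factors by which its rows change. Setting the
    -- vector to zero elsewhere keeps it null and gives the local support as well; with M = N this
    -- localizes a null vector.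
    transfer : ∀ {w} → Supp N w → Supp M w × SuppOn (Connected F w) M w
    transfer {w} (x , Nx≈0 , xw≉0) =
      (y , My≈0 , yw≉0) , [] , y , ((λ u ¬p → off ¬p) , λ u _ → My≈0 u) , yw≉0
      where
      r c′ y : Vect n
      r u  = proj₁ (potential forest equivalence w (1# , 1#) u)
      c′ u = proj₂ (potential forest equivalence w (1# , 1#) u)
      y u  = if does (connected? forest w u) then c′ u * x u else 0#

      on : ∀ {u} → Connected F w u → y u ≈ c′ u * x u
      on {u} p rewrite dec-true (connected? forest w u) p = refl

      off : ∀ {u} → ¬ Connected F w u → y u ≈ 0#
      off {u} ¬p rewrite dec-false (connected? forest w u) ¬p = refl

      yw≉0 : ¬ (y w ≈ 0#)
      yw≉0 yw≈0 = xw≉0 (trans (sym (*-identityˡ _)) (trans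
        (*-congʳ (sym (proj₂ (potential-walk forest equivalence {w} {w} (1# , 1#) []))))
        (trans (sym (on [])) yw≈0)))

      My≈0 : Null M y
      My≈0 u with connected? forest w u
      ... | no ¬p = row-zero M∈ u λ e → off λ q → ¬p (q ++ʷ (symm e ∷ []))
      ... | yes p = row-null M∈ N∈ Nx≈0 u (r u) λ {t} e → begin
        M u t * y t                                    ≈⟨ *-congˡ (on (p ++ʷ (e ∷ []))) ⟩
        M u t * (c′ t * x t)
          ≈⟨ *-congˡ (*-congʳ (proj₂ (potential-step forest equivalence _ p e))) ⟩
        M u t * (r u * (N u t * M u t ⁻¹) * x t)       ≈⟨ *-congˡ (*-assoc _ _ _) ⟩
        M u t * (r u * (N u t * M u t ⁻¹ * x t))       ≈⟨ x∙yz≈y∙xz _ _ _ ⟩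
        r u * (M u t * (N u t * M u t ⁻¹ * x t))       ≈⟨ *-congˡ (*-assoc _ _ _) ⟨
        r u * (M u t * (N u t * M u t ⁻¹) * x t)
          ≈⟨ *-congˡ (*-congʳ (x∙yz≈y∙xz _ _ _)) ⟩
        r u * (N u t * (M u t * M u t ⁻¹) * x t)
          ≈⟨ *-congˡ (*-congʳ (trans (*-congˡ (⁻¹-inverse _ (entry-nonzero M∈ e))) (*-identityʳ _))) ⟩
        r u * (N u t * x t)                            ∎

  restrict : ∀ {M w} → M ∈𝓜₀ F → Supp M w → SuppOn (Connected F w) M w
  restrict M∈ w∈ = proj₂ (transfer M∈ M∈ w∈)

  -- Rows outside the component of v meet the vector in vanishing entries only.
  extend : ∀ {M v w} → M ∈𝓜₀ F → SuppOn (Connected F v) M w → Supp M w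
  extend {M} {v} M∈ (_ , x , (off , on) , xw≉0) = x , Mx≈0 , xw≉0
    where
    Mx≈0 : Null M x
    Mx≈0 u with connected? forest v u
    ... | yes p = on u p
    ... | no ¬p = row-zero M∈ u λ e → off _ λ q → ¬p (q ++ʷ (symm e ∷ []))


  dot-symmetric : ∀ (x y : Vect n) → sum (λ w → (A F *ᵥ y) w * x w) ≈ sum (λ a → y a * (A F *ᵥ x) a)
  dot-symmetric x y = begin
    sum (λ w → sum (λ a → A F w a * y a) * x w)
      ≈⟨ sum-cong-≋ (λ w → *-distribʳ-sum (x w) (λ a → A F w a * y a)) ⟩
    sum (λ w → sum (λ a → A F w a * y a * x w))
      ≈⟨ ∑-comm (λ w a → A F w a * y a * x w) ⟩
    sum (λ a → sum (λ w → A F w a * y a * x w))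
      ≈⟨ sum-cong-≋ (λ a → trans (sum-cong-≋ λ w → move w a)
           (sym (*-distribˡ-sum (y a) (λ w → A F a w * x w)))) ⟩
    sum (λ a → y a * (A F *ᵥ x) a) ∎
    where
    move : ∀ w a → A F w a * y a * x w ≈ y a * (A F a w * x w)
    move w a = trans (*-congʳ (trans (*-comm _ _) (*-congˡ (A-symmetric w a)))) (*-assoc _ _ _)

  -- Restrict x to the vertices at even distance from u that are on the side
  -- of u with respect to the edge u t.  The result is annihilated by every
  -- row of A F except that of t, where it gives x u.

  module _ {u t : Fin n} (e : u ~ t) where

    private
      crosses : Fin n → Fin n → Bool
      crosses a b = does (a ≟ u) ∧ does (b ≟ t) ∨ does (b ≟ u) ∧ does (a ≟ t)

      -- The first bit records even distance from u, the second whether the vertex lies on the side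
      -- of u. Each step flips the parity, and only the edge u t, in either direction, flips the
      -- side; two flips cancel.
      side : Gauge (≡.setoid (Bool × Bool))
      side = record
        { step   = λ {a} {b} _ (even , near) → not even , near xor crosses a b
        ; cong   = λ _ → ≡.cong _
        ; cancel = λ {a} {b} _ _ (even , near) → ≡.cong₂ _,_ (not-involutive even) (≡.trans
            (xor-assoc near (crosses a b) (crosses b a)) (≡.trans
              (≡.cong (near xor_) (≡.trans
                (≡.cong (crosses a b xor_) (∨-comm (does (b ≟ u) ∧ does (a ≟ t)) _))
                (xor-same (crosses a b))))
              (xor-identityʳ near)))
        }

      position : Fin n → Bool × Bool
      position = potential forest side u (true , true)

      χ : Fin n → Bool
      χ w = proj₁ (position w) ∧ proj₂ (position w)

      position-u : position u ≡ (true , true)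
      position-u = potential-walk forest side {u} {u} _ []

      position-step : ∀ {a b} → Connected F u a → a ~ b →
        position b ≡ (not (proj₁ (position a)) , proj₂ (position a) xor crosses a b)
      position-step = potential-step forest side _

      u≢t : u ≢ t
      u≢t ≡.refl = irrefl ≡.refl e

      -- Neighbours of w share their parity and, unless w is u, also their side; the neighbours of u
      -- are odd, so their side does not matter. Hence row w of A x′ is row w of A x or has only
      -- zero terms.
      χ-uniform : ∀ {w} → w ≢ t → ∃ λ b → ∀ {a} → w ~ a → χ a ≡ b
      χ-uniform {w} w≢t with connected? forest u w
      -- Off the component of u `position` keeps its initial value (true , true).
      ... | no ¬p = true , λ e′ → ≡.cong (λ (p , s) → p ∧ s)
        (potential-off forest side _ λ q → ¬p (q ++ʷ (symm e′ ∷ [])))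
      ... | yes p with w ≟ u
      ... | yes ≡.refl = false , λ {a} e′ → ≡.trans
        (≡.cong (λ (p , s) → p ∧ s) (position-step p e′))
        (≡.cong (λ (p , _) → not p ∧ (proj₂ (position w) xor crosses w a)) position-u)
      ... | no w≢u = not (proj₁ (position w)) ∧ proj₂ (position w) , λ {a} e′ → ≡.trans
        (≡.cong (λ (p , s) → p ∧ s) (position-step p e′))
        (≡.cong (not (proj₁ (position w)) ∧_) (≡.trans
          (≡.cong (proj₂ (position w) xor_) (uncrossed a)) (xor-identityʳ _)))
        where
        uncrossed : ∀ a → crosses w a ≡ false
        uncrossed a rewrite dec-false (w ≟ u) w≢u | dec-false (w ≟ t) w≢t = ∧-zeroʳ _

      position-t : position t ≡ (false , false)
      position-t = ≡.trans (position-step [] e) (≡.trans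
        (≡.cong (λ (p , s) → not p , s xor crosses u t) position-u)
        (≡.cong (λ s → false , not s) crossed))
        where
        crossed : crosses u t ≡ true
        crossed rewrite dec-true (u ≟ u) ≡.refl | dec-true (t ≟ t) ≡.refl = ≡.refl

      -- t lies on the far side, and the only edge leading back from there is the one to u.
      χ-t : ∀ {a} → t ~ a → a ≢ u → χ a ≡ false
      χ-t {a} e′ a≢u = ≡.trans
        (≡.cong (λ (p , s) → p ∧ s) (position-step (e ∷ []) e′))
        (≡.trans (≡.cong (λ (p , s) → not p ∧ (s xor crosses t a)) position-t) uncrossed)
        where
        uncrossed : crosses t a ≡ false
        uncrossed rewrite dec-false (t ≟ u) (u≢t ∘ ≡.sym) | dec-false (a ≟ u) a≢u = ≡.refl

    adjacent-product : ∀ {x} → Null (A F) x → x u * x t ≈ 0#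
    adjacent-product {x} Ax≈0 = begin
      x u * x t                        ≈⟨ *-congʳ Ax′t≈xu ⟨
      (A F *ᵥ x′) t * x t              ≈⟨ sum-single t (λ w w≢t → trans (*-congʳ (Ax′≈0 w≢t)) (zeroˡ _)) ⟨
      sum (λ w → (A F *ᵥ x′) w * x w)  ≈⟨ dot-symmetric x x′ ⟩
      sum (λ a → x′ a * (A F *ᵥ x) a)  ≈⟨ sum-trivial (λ a → trans (*-congˡ (Ax≈0 a)) (zeroʳ _)) ⟩
      0#                               ∎
      where
      x′ : Vect n
      x′ w = if χ w then x w else 0#

      x′-in : ∀ {w} → χ w ≡ true → x′ w ≈ x w
      x′-in eq rewrite eq = refl

      x′-out : ∀ {w} → χ w ≡ false → x′ w ≈ 0#
      x′-out eq rewrite eq = refl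

      Ax′≈0 : ∀ {w} → w ≢ t → (A F *ᵥ x′) w ≈ 0#
      Ax′≈0 {w} w≢t with χ-uniform w≢t
      ... | true  , all = row-null A∈𝓜₀ A∈𝓜₀ Ax≈0 w 1# λ e′ →
        trans (*-congˡ (x′-in (all e′))) (sym (*-identityˡ _))
      ... | false , all = row-zero A∈𝓜₀ w λ e′ → x′-out (all e′)

      Ax′t≈xu : (A F *ᵥ x′) t ≈ x u
      Ax′t≈xu = trans (sum-single u others) (trans
        (*-cong (A-edge (symm e)) (x′-in (≡.cong (λ (p , s) → p ∧ s) position-u))) (*-identityˡ _))
        where
        others : ∀ a → a ≢ u → A F t a * x′ a ≈ 0#
        others a a≢u with t ~? a
        ... | yes e′ = trans (*-congˡ (x′-out (χ-t e′ a≢u))) (zeroʳ _)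
        ... | no _   = zeroˡ _

  -- The supports at u and t may come from different null vectors x and y, whereas
  -- `adjacent-product` concerns a single one. Applied to each of them it gives x t = 0 and y u = 0,
  -- so x + y is nonzero at both ends, which it then excludes.
  Supp-independent : ∀ {M} → M ∈𝓜₀ F → ∀ {u t} → u ~ t → Supp M u → ¬ Supp M t
  Supp-independent M∈ {u} {t} e u∈M t∈M
    with proj₁ (transfer A∈𝓜₀ M∈ u∈M) | proj₁ (transfer A∈𝓜₀ M∈ t∈M)
  ... | x , Ax≈0 , xu≉0 | y , Ay≈0 , yt≉0 =
    *-nonzero zu≉0 zt≉0 (adjacent-product e Az≈0)
    where
    xt≈0 : x t ≈ 0#
    xt≈0 = *-cancelˡ-0 xu≉0 (adjacent-product e Ax≈0)

    yu≈0 : y u ≈ 0#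
    yu≈0 = *-cancelˡ-0 yt≉0 (adjacent-product (symm e) Ay≈0)

    z : Vect n
    z w = x w + y w

    zu≉0 : ¬ (z u ≈ 0#)
    zu≉0 zu≈0 = xu≉0 (trans (sym (trans (+-congˡ yu≈0) (+-identityʳ _))) zu≈0)

    zt≉0 : ¬ (z t ≈ 0#)
    zt≉0 zt≈0 = yt≉0 (trans (sym (trans (+-congʳ xt≈0) (+-identityˡ _))) zt≈0)

    Az≈0 : Null (A F) z
    Az≈0 w = begin
      sum (λ a → A F w a * (x a + y a))          ≈⟨ sum-cong-≋ (λ a → distribˡ (A F w a) (x a) (y a)) ⟩
      sum (λ a → A F w a * x a + A F w a * y a)  ≈⟨ ∑-distrib-+ (λ a → A F w a * x a) _ ⟩
      (A F *ᵥ x) w + (A F *ᵥ y) w                ≈⟨ +-cong (Ax≈0 w) (Ay≈0 w) ⟩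
      0# + 0#                                    ≈⟨ +-identityˡ 0# ⟩
      0#                                         ∎

-- The diagonal matrix of a choice of roots and the two null spaces.

module Diagonal {c ℓ} (K : Field c ℓ) {n : ℕ} (F : Graph n) (forest : IsForest F)
                (M : Linear.Matrix K n) (M∈ : Linear._∈𝓜₀_ K M F) where
  open Field K renaming (zero to *-zero)
  open Linear K
  open FieldProperties K
  open LinearProperties K hiding (sum-trivial; sum-single)
  open Graph F
  open Forests F
  open Supports K F forest
  open SingleTerm *-commutativeMonoid using ()
    renaming (sum-trivial to product-trivial; sum-single to product-single)
  open CommutativeSemigroupProperties *-commutativeSemigroup using (interchange)
  open SetoidReasoning setoid

  factor : Fin n → Fin n → Carrier
  factor u t = leaving F M u t * entering F M u t

  private
    leaving-entering : ∀ {u t} → t ~ u → leaving F M u t * entering F M t u ≈ 1#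
    leaving-entering {u} {t} e with does (supp? M u)
    ... | true  = ⁻¹-inverseˡ (entry-nonzero M∈ e)
    ... | false = *-identityˡ 1#

    leaving-nonzero : ∀ {u t} → u ~ t → ¬ (leaving F M u t ≈ 0#)
    leaving-nonzero {u} e with does (supp? M u)
    ... | true  = ⁻¹-nonzero (entry-nonzero M∈ (symm e))
    ... | false = 1≉0

    entering-nonzero : ∀ {u t} → u ~ t → ¬ (entering F M u t ≈ 0#)
    entering-nonzero {_} {t} e with does (supp? M t)
    ... | true  = entry-nonzero M∈ e
    ... | false = 1≉0

  -- `leaving u t` and `entering t u` involve the same entry M t u under the same condition on u,
  -- and likewise with u and t exchanged. Inverting M u t instead would break this whenever M u t
  -- and M t u differ and u alone is in the support.
  factor-cancel : ∀ {u t} → u ~ t → factor u t * factor t u ≈ 1#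
  factor-cancel {u} {t} e = begin
    leaving F M u t * entering F M u t * (leaving F M t u * entering F M t u)
      ≈⟨ *-congˡ (*-comm _ _) ⟩
    leaving F M u t * entering F M u t * (entering F M t u * leaving F M t u)
      ≈⟨ interchange _ _ _ _ ⟩
    leaving F M u t * entering F M t u * (entering F M u t * leaving F M t u)
      ≈⟨ *-cong (leaving-entering (symm e)) (trans (*-comm _ _) (leaving-entering e)) ⟩
    1# * 1#  ≈⟨ *-identityˡ 1# ⟩
    1#       ∎

  factor-nonzero : ∀ {u t} → u ~ t → ¬ (factor u t ≈ 0#)
  factor-nonzero e = *-nonzero (leaving-nonzero e) (entering-nonzero e)

  private
    scaling : Gauge setoid
    scaling = record
      { step   = λ {u} {t} _ x → x * factor u t
      ; cong   = λ _ → *-congʳ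
      ; cancel = λ e _ _ → *-cancel-mid (factor-cancel e)
      }
    open Gauge scaling using (transport)

    transport-product : ∀ {v w} (p : Walk F v w) x → transport p x ≈ x * pathProduct F M p
    transport-product []      x = sym (*-identityʳ x)
    transport-product (_ ∷ p) x = trans (transport-product p _) (*-assoc _ _ _)

    pathProduct-nonzero : ∀ {v w} (p : Walk F v w) → ¬ (pathProduct F M p ≈ 0#)
    pathProduct-nonzero []      = 1≉0
    pathProduct-nonzero (e ∷ p) = *-nonzero (factor-nonzero e) (pathProduct-nonzero p)

    Dᵛ≈potential : ∀ v w → Dᵛ-entry F M v w ≈ potential forest scaling v 1# w
    Dᵛ≈potential v w with path? F v w
    ... | yes (p , _) = sym (trans (transport-product p 1#) (*-identityˡ _))
    ... | no _        = refl

    Dᵛ-off : ∀ {v w} → ¬ Connected F v w → Dᵛ-entry F M v w ≈ 1#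
    Dᵛ-off {v} {w} ¬p = trans (Dᵛ≈potential v w) (reflexive (potential-off forest scaling 1# ¬p))

    Dᵛ-nonzero : ∀ v w → ¬ (Dᵛ-entry F M v w ≈ 0#)
    Dᵛ-nonzero v w with path? F v w
    ... | yes (p , _) = pathProduct-nonzero p
    ... | no _        = 1≉0

  module _ (U : Subset n) (single : ∀ {v w} → v ∈ U → w ∈ U → Connected F v w → v ≡ w) where

    private
      D : Vect n
      D = Dᵁ-entry F M U

    -- U meets the component of w in v alone, so every other factor of the product is 1.
    Dᵁ-connected : ∀ {v w} → v ∈ U → Connected F v w → D w ≈ Dᵛ-entry F M v w
    Dᵁ-connected {v} {w} v∈U p = trans (product-single v others) at-v
      where
      others : ∀ u → u ≢ v → (if does (u ∈? U) then Dᵛ-entry F M u w else 1#) ≈ 1#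
      others u u≢v with u ∈? U
      ... | yes u∈U = Dᵛ-off λ q → u≢v (single u∈U v∈U (q ++ʷ reverseʷ p))
      ... | no _    = refl

      at-v : (if does (v ∈? U) then Dᵛ-entry F M v w else 1#) ≈ Dᵛ-entry F M v w
      at-v rewrite dec-true (v ∈? U) v∈U = refl

    Dᵁ-off : ∀ {w} → (∀ {v} → v ∈ U → ¬ Connected F v w) → D w ≈ 1#
    Dᵁ-off {w} ¬p = product-trivial trivial
      where
      trivial : ∀ v → (if does (v ∈? U) then Dᵛ-entry F M v w else 1#) ≈ 1#
      trivial v with v ∈? U
      ... | yes v∈U = Dᵛ-off (¬p v∈U)
      ... | no _    = refl

    Dᵁ-root : ∀ {v} → v ∈ U → D v ≈ 1#
    Dᵁ-root {v} v∈U = trans (Dᵁ-connected v∈U []) (trans (Dᵛ≈potential v v)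
      (potential-walk forest scaling {v} {v} 1# []))

    Dᵁ-step : ∀ {v u t} → v ∈ U → Connected F v u → u ~ t → D t ≈ D u * factor u t
    Dᵁ-step {v} {u} {t} v∈U p e = begin
      D t                                      ≈⟨ Dᵁ-connected v∈U (p ++ʷ (e ∷ [])) ⟩
      Dᵛ-entry F M v t                         ≈⟨ Dᵛ≈potential v t ⟩
      potential forest scaling v 1# t          ≈⟨ potential-step forest scaling 1# p e ⟩
      potential forest scaling v 1# u * factor u t
        ≈⟨ *-congʳ (trans (Dᵁ-connected v∈U p) (Dᵛ≈potential v u)) ⟨
      D u * factor u t                         ∎

    Dᵁ-nonzero : ∀ w → ¬ (D w ≈ 0#)
    Dᵁ-nonzero w with any? (λ v → v ∈? U ×-dec connected? forest v w)
    ... | yes (v , v∈U , p) = Dᵛ-nonzero v w ∘ trans (sym (Dᵁ-connected v∈U p))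
    ... | no none           = 1≉0 ∘ trans (sym (Dᵁ-off λ v∈U p → none (_ , v∈U , p)))

    Dᵁ⁻¹-inverse : IsInverse (Dᵁ⁻¹ F M U) (Dᵁ F M U)
    Dᵁ⁻¹-inverse = diag-inverse {d = D} λ u → ⁻¹-inverseˡ (Dᵁ-nonzero u)

  module _ {U : Subset n} (choice : IsChoice F U) where
    open IsChoice choice

    private
      D : Vect n
      D = Dᵁ-entry F M U

    -- Since the null support is independent, the factor of an edge entering
    -- it is the single entry M u t.

    D-supp : ∀ {u t} → u ~ t → Supp M t → D t ≈ D u * M u t
    -- As t also lies in the support of A on its own component, that component contains a root, and
    -- D is carried from there to u and on to t.
    D-supp {u} {t} e t∈M with every t (restrict A∈𝓜₀ (proj₁ (transfer A∈𝓜₀ M∈ t∈M)))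
    ... | v , v∈U , p =
      trans (Dᵁ-step U single v∈U (reverseʷ p ++ʷ (symm e ∷ [])) e) (*-congˡ factor≈)
      where
      factor≈ : factor u t ≈ M u t
      factor≈ rewrite dec-false (supp? M u) (λ u∈M → Supp-independent M∈ e u∈M t∈M)
                    | dec-true (supp? M t) t∈M = *-identityˡ (M u t)

    D⁻¹-supp : ∀ {u t} → u ~ t → Supp M t → M u t * D t ⁻¹ ≈ D u ⁻¹
    D⁻¹-supp {u} {t} e t∈M = ⁻¹-unique (begin
      D u * (M u t * D t ⁻¹)  ≈⟨ *-assoc _ _ _ ⟨
      D u * M u t * D t ⁻¹    ≈⟨ *-congʳ (D-supp e t∈M) ⟨
      D t * D t ⁻¹            ≈⟨ ⁻¹-inverse _ (Dᵁ-nonzero U single t) ⟩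
      1#                      ∎)

    private
      supported : ∀ {N} {x : Vect n} {t} → Null N x → x t ≈ 0# ⊎ Supp N t
      supported {x = x} {t} Nx≈0 with x t ≈? 0#
      ... | yes xt≈0 = inj₁ xt≈0
      ... | no xt≉0  = inj₂ (x , Nx≈0 , xt≉0)

      x*y≈0 : ∀ {x y} → y ≈ 0# → x * y ≈ 0#
      x*y≈0 y≈0 = trans (*-congˡ y≈0) (zeroʳ _)

    -- `D⁻¹-supp` is available only for neighbours in the support, but at the others x vanishes and
    -- both terms are zero. In a component without a root every vertex is of the second kind.
    Null-A→M : ∀ {x y : Vect n} → Null (A F) x → (∀ u → y u ≈ D u ⁻¹ * x u) → Null M y
    Null-A→M {x} {y} Ax≈0 y≈ u = row-null M∈ A∈𝓜₀ Ax≈0 u (D u ⁻¹) edge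
      where
      edge : ∀ {t} → u ~ t → M u t * y t ≈ D u ⁻¹ * (A F u t * x t)
      edge {t} e with supported Ax≈0
      ... | inj₁ xt≈0 = trans (x*y≈0 (trans (y≈ t) (x*y≈0 xt≈0))) (sym (x*y≈0 (x*y≈0 xt≈0)))
      ... | inj₂ t∈A  = begin
        M u t * y t                 ≈⟨ *-congˡ (y≈ t) ⟩
        M u t * (D t ⁻¹ * x t)      ≈⟨ *-assoc _ _ _ ⟨
        M u t * D t ⁻¹ * x t
          ≈⟨ *-cong (D⁻¹-supp e (proj₁ (transfer M∈ A∈𝓜₀ t∈A))) (sym (*-identityˡ _)) ⟩
        D u ⁻¹ * (1# * x t)         ≈⟨ *-congˡ (*-congʳ (A-edge e)) ⟨
        D u ⁻¹ * (A F u t * x t)    ∎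

    Null-M→A : ∀ {x y : Vect n} → Null M y → (∀ u → x u ≈ D u * y u) → Null (A F) x
    Null-M→A {x} {y} My≈0 x≈ u = row-null A∈𝓜₀ M∈ My≈0 u (D u) edge
      where
      edge : ∀ {t} → u ~ t → A F u t * x t ≈ D u * (M u t * y t)
      edge {t} e with supported My≈0
      ... | inj₁ yt≈0 = trans (x*y≈0 (trans (x≈ t) (x*y≈0 yt≈0))) (sym (x*y≈0 (x*y≈0 yt≈0)))
      ... | inj₂ t∈M  = begin
        A F u t * x t            ≈⟨ *-cong (A-edge e) (x≈ t) ⟩
        1# * (D t * y t)         ≈⟨ *-identityˡ _ ⟩
        D t * y t                ≈⟨ *-congʳ (D-supp e t∈M) ⟩
        D u * M u t * y t        ≈⟨ *-assoc _ _ _ ⟩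
        D u * (M u t * y t)      ∎

    Dᵁ⁻¹-sparsest : ∀ {k} {B B′ : Fin k → Vect n} → IsSparsestBasis (Null (A F)) B →
                    (∀ i u → B′ i u ≈ D u ⁻¹ * B i u) → IsSparsestBasis (Null M) B′
    Dᵁ⁻¹-sparsest sparsest B′≈ =
      scale-sparsest {d = D} (λ u → ⁻¹-inverseˡ (Dᵁ-nonzero U single u)) Null-A→M Null-M→A B′≈ sparsest

-- Counting over lists and sparse vectors.

module Totals {a} {X : Set a} where
  open import Data.Nat using (_+_; _*_)
  open CommutativeSemigroupProperties ℕₚ.+-commutativeSemigroup using (x∙yz≈y∙xz)

  total : (X → ℕ) → List X → ℕ
  total f xs = ListAction.sum (map f xs)

  total-++ : ∀ f xs ys → total f (xs ++ ys) ≡ total f xs + total f ys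
  total-++ f xs ys = ≡.trans (≡.cong ListAction.sum (map-++ f xs ys)) (sum-++ (map f xs) (map f ys))

  total-cong : ∀ {f g : X → ℕ} {xs} → All (λ x → f x ≡ g x) xs → total f xs ≡ total g xs
  total-cong []         = ≡.refl
  total-cong (eq ∷ eqs) = ≡.cong₂ _+_ eq (total-cong eqs)

  total-suc : ∀ f xs → total (suc ∘ f) xs ≡ length xs + total f xs
  total-suc f []       = ≡.refl
  total-suc f (x ∷ xs) = ≡.cong suc (≡.trans (≡.cong (f x +_) (total-suc f xs))
    (x∙yz≈y∙xz (f x) (length xs) (total f xs)))

  total-const : ∀ k xs → total (λ _ → k) xs ≡ k * length xs
  total-const k []       = ≡.sym (ℕₚ.*-zeroʳ k)
  total-const k (_ ∷ xs) = ≡.trans (≡.cong (k +_) (total-const k xs)) (≡.sym (ℕₚ.*-suc k (length xs)))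

  total-* : ∀ k f xs → total (λ x → k * f x) xs ≡ k * total f xs
  total-* k f []       = ≡.sym (ℕₚ.*-zeroʳ k)
  total-* k f (x ∷ xs) = ≡.trans (≡.cong (k * f x +_) (total-* k f xs)) (≡.sym (ℕₚ.*-distribˡ-+ k (f x) _))

  length≡total : ∀ xs → length xs ≡ total (λ _ → 1) xs
  length≡total xs = ≡.sym (≡.trans (total-const 1 xs) (ℕₚ.*-identityˡ _))

  total-mono : ∀ {f g : X → ℕ} → (∀ x → f x ≤ g x) → ∀ xs → total f xs ≤ total g xs
  total-mono f≤g []       = z≤n
  total-mono f≤g (x ∷ xs) = ℕₚ.+-mono-≤ (f≤g x) (total-mono f≤g xs)

  -- One occurrence of the head of xs is removed from ys; as xs has no repetitions, the rest of xs
  -- stays inside. This turns distinctness of visited vertices into bounds on running time.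
  total-⊆ : ∀ f {xs ys} → Unique xs → xs ⊆ˡ ys → total f xs ≤ total f ys
  total-⊆ f {[]}     _            _     = z≤n
  total-⊆ f {x ∷ xs} (x∉ ∷ uniq) xs⊆ys with ∈-∃++ (xs⊆ys (here ≡.refl))
  ... | as , bs , ≡.refl = ℕₚ.≤-trans
    (ℕₚ.+-monoʳ-≤ (f x) (total-⊆ f uniq xs⊆))
    (ℕₚ.≤-reflexive (≡.sym (sum-↭ (↭-map⁺ f (shift x as bs)))))
    where
    xs⊆ : xs ⊆ˡ as ++ bs
    xs⊆ y∈xs with ∈-++⁻ as (xs⊆ys (there y∈xs))
    ... | inj₁ y∈as             = ∈-++⁺ˡ y∈as
    ... | inj₂ (here ≡.refl)    = contradiction y∈xs (All¬⇒¬Any x∉)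
    ... | inj₂ (there y∈bs)     = ∈-++⁺ʳ as y∈bs

  length-⊆ : ∀ {xs ys : List X} → Unique xs → xs ⊆ˡ ys → length xs ≤ length ys
  length-⊆ {xs} {ys} uniq xs⊆ys =
    ≡.subst₂ _≤_ (≡.sym (length≡total xs)) (≡.sym (length≡total ys)) (total-⊆ (λ _ → 1) uniq xs⊆ys)

open Totals

total-allFin : ∀ {n} (f : Fin n → ℕ) → total f (allFin n) ≡ MonoidSum.sum ℕₚ.+-0-commutativeMonoid f
total-allFin f = ≡.trans (≡.cong ListAction.sum (map-tabulate id f)) (sum-tabulate f)
  where
  sum-tabulate : ∀ {n} (f : Fin n → ℕ) →
                 ListAction.sum (tabulate f) ≡ MonoidSum.sum ℕₚ.+-0-commutativeMonoid f
  sum-tabulate {zero}  f = ≡.refl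
  sum-tabulate {suc n} f = ≡.cong (f zero ℕ.+_) (sum-tabulate (f ∘ suc))

length-unique : ∀ {n} {xs : List (Fin n)} → Unique xs → length xs ≤ n
length-unique {n} {xs} uniq =
  ≡.subst (length xs ≤_) (length-tabulate id) (length-⊆ {ys = allFin n} uniq λ _ → ∈-allFin _)

sum-lookup : ∀ {a} {X : Set a} (f : X → ℕ) xs →
             MonoidSum.sum ℕₚ.+-0-commutativeMonoid (λ i → f (List.lookup xs i)) ≡ total f xs
sum-lookup f []       = ≡.refl
sum-lookup f (x ∷ xs) = ≡.cong (f x ℕ.+_) (sum-lookup f xs)

module SparseVectors {c ℓ} (K : Field c ℓ) {n : ℕ} where
  open Field K renaming (zero to *-zero)
  open Linear K
  open Algorithm K

  ⟦⟧-∈ : ∀ {s : SparseVect n} → Unique (map proj₁ s) → ∀ {w a} → (w , a) ∈ˡ s → ⟦ s ⟧ w ≡ a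
  ⟦⟧-∈ _            {w} (here ≡.refl) rewrite dec-true (w ≟ w) ≡.refl = ≡.refl
  ⟦⟧-∈ {(w′ , _) ∷ _} (w′∉ ∷ uniq) {w} (there wa∈)
    rewrite dec-false (w′ ≟ w) (All.lookup w′∉ (∈-map⁺ proj₁ wa∈)) = ⟦⟧-∈ uniq wa∈

  ⟦⟧-∉ : ∀ (s : SparseVect n) {w} → w ∉ˡ map proj₁ s → ⟦ s ⟧ w ≡ 0#
  ⟦⟧-∉ []             _   = ≡.refl
  ⟦⟧-∉ ((w′ , _) ∷ s) {w} w∉
    rewrite dec-false (w′ ≟ w) (λ { ≡.refl → w∉ (here ≡.refl) }) = ⟦⟧-∉ s (w∉ ∘ there)

  key-nonzero : ∀ {s : SparseVect n} → IsReduced s → ∀ {w} → w ∈ˡ map proj₁ s → ¬ (⟦ s ⟧ w ≈ 0#)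
  key-nonzero (uniq , nonzero) w∈ with ∈-map⁻ proj₁ w∈
  ... | _ , wa∈ , ≡.refl rewrite ⟦⟧-∈ uniq wa∈ = All.lookup nonzero wa∈

  nonzero-key : ∀ (s : SparseVect n) {w} → ¬ (⟦ s ⟧ w ≈ 0#) → w ∈ˡ map proj₁ s
  nonzero-key []             ≉0 = contradiction refl ≉0
  nonzero-key ((w′ , a) ∷ s) {w} ≉0 with w′ ≟ w
  ... | yes ≡.refl = here ≡.refl
  ... | no _       = there (nonzero-key s ≉0)

  -- The keys and the nonzero positions are lists without repetitions that contain each other.
  nnz-reduced : ∀ {s : SparseVect n} → IsReduced s → nnz ⟦ s ⟧ ≡ length s
  nnz-reduced {s} red = ≡.trans
    (ℕₚ.≤-antisym
      (length-⊆ (filter⁺ nonzero? (allFin⁺ n)) (nonzero-key s ∘ proj₂ ∘ ∈-filter⁻ nonzero? {xs = allFin n}))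
      (length-⊆ (proj₁ red) λ w∈ → ∈-filter⁺ nonzero? (∈-allFin _) (key-nonzero red w∈)))
    (length-map proj₁ s)
    where
    nonzero? : ∀ u → Dec (¬ (⟦ s ⟧ u ≈ 0#))
    nonzero? u = ¬? (⟦ s ⟧ u ≈? 0#)

-- Depth-first traversal: values, cost, distinctness and completeness.

module Traversal {c ℓ} (K : Field c ℓ) {n : ℕ} (F : Graph n) (forest : IsForest F)
                 (M : Linear.Matrix K n) (M∈ : Linear._∈𝓜₀_ K M F)
                 (rows : Algorithm.SparseMatrix K n) (form : Algorithm.IsSparseFormOf K rows M) where
  open Field K hiding (zero; _+_; _*_)
  open import Data.Nat using (_+_; _*_)
  open Linear K
  open Algorithm K
  open Graph F
  open Forests F
  open Supports K F forest
  open SparseVectors K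

  row : Fin n → SparseVect n
  row = Vec.lookup rows

  key⇒edge : ∀ {u w} → w ∈ˡ map proj₁ (row u) → u ~ w
  key⇒edge {u} {w} w∈ = decide (u ~? w)
    where
    decide : Dec (u ~ w) → u ~ w
    decide (yes e) = e
    decide (no ¬e) = contradiction
      (trans (proj₂ (form u) w) (entry-zero M∈ ¬e)) (key-nonzero (proj₁ (form u)) w∈)

  edge⇒key : ∀ {u w} → u ~ w → w ∈ˡ map proj₁ (row u)
  edge⇒key {u} {w} e =
    nonzero-key (row u) (entry-nonzero M∈ e ∘ trans (sym (proj₂ (form u) w)))

  entry-value : ∀ {u w a} → (w , a) ∈ˡ row u → a ≈ M u w
  entry-value {u} {w} wa∈ =
    trans (reflexive (≡.sym (⟦⟧-∈ (proj₁ (proj₁ (form u))) wa∈))) (proj₂ (form u) w)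

  mutual
    -- The value of `explore` without costs and without accumulator, so that membership and
    -- distinctness can be proved by following the recursion.
    tour : ℕ → (p v : Fin n) → List Edge
    tour zero    p v = []
    tour (suc k) p v = tours k p v (row v)

    tours : ℕ → (p v : Fin n) → SparseVect n → List Edge
    tours k p v []            = []
    tours k p v ((t , a) ∷ s) =
      if does (t ≟ p) then tours k p v s else (v , t , a) ∷ tour k v t ++ tours k p v s

  mutual
    explore-value : ∀ k p v rest → value (explore k rows p v rest) ≡ tour k p v ++ rest
    explore-value zero    p v rest = ≡.refl
    explore-value (suc k) p v rest = branches-value k p v (row v) rest

    branches-value : ∀ k p v s rest → value (branches k rows p v s rest) ≡ tours k p v s ++ rest
    branches-value k p v []            rest = ≡.refl
    branches-value k p v ((t , a) ∷ s) rest with does (t ≟ p)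
    ... | true  = branches-value k p v s rest
    ... | false = ≡.cong ((v , t , a) ∷_) (≡.trans
      (explore-value k v t _) (≡.trans
      (≡.cong (tour k v t ++_) (branches-value k p v s rest))
      (≡.sym (++-assoc (tour k v t) (tours k p v s) rest))))

  target : Edge → Fin n
  target (_ , t , _) = t

  targets : List Edge → List (Fin n)
  targets = map target

  visited : Fin n → List (Fin n)
  visited v = v ∷ targets (tour n v v)

  traverse-value : ∀ v → value (traverse rows v) ≡ tour n v v
  traverse-value v = ≡.trans (explore-value n v v []) (++-identityʳ _)

  weight : Fin n → ℕ
  weight w = suc (length (row w))

  mutual
    -- A visit costs three steps, for the call, the access to the row and the end of the row, and
    -- two further steps per row entry, for the cell and the comparison with the parent. Three times
    -- the weight covers both.
    explore-time : ∀ k p v rest →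
      time (explore k rows p v rest) ≤ 3 * total weight (v ∷ targets (tour k p v))
    explore-time zero    p v rest = s≤s z≤n
    explore-time (suc k) p v rest = begin
      2 + time (branches k rows p v (row v) rest)
        ≤⟨ ℕₚ.+-monoʳ-≤ 2 (branches-time k p v (row v) rest) ⟩
      2 + (1 + 2 * d + 3 * T)
        ≤⟨ ℕₚ.m≤m+n _ d ⟩
      2 + (1 + 2 * d + 3 * T) + d
        ≡⟨ arithmetic d T ⟩
      3 * (suc d + T) ∎
      where
      open ℕₚ.≤-Reasoning
      d = length (row v)
      T = total weight (targets (tours k p v (row v)))
      arithmetic : ∀ d T → 2 + (1 + 2 * d + 3 * T) + d ≡ 3 * (suc d + T)
      arithmetic = solve-∀

    branches-time : ∀ k p v s rest →
      time (branches k rows p v s rest) ≤ 1 + 2 * length s + 3 * total weight (targets (tours k p v s))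
    branches-time k p v []            rest = s≤s z≤n
    branches-time k p v ((t , a) ∷ s) rest with does (t ≟ p)
    ... | true  = begin
      suc (time later + 1)
        ≤⟨ ℕₚ.+-monoʳ-≤ 1 (ℕₚ.+-monoˡ-≤ 1 (branches-time k p v s rest)) ⟩
      suc (1 + 2 * length s + 3 * T + 1)
        ≡⟨ arithmetic (length s) T ⟩
      1 + 2 * suc (length s) + 3 * T ∎
      where
      open ℕₚ.≤-Reasoning
      later = branches k rows p v s rest
      T = total weight (targets (tours k p v s))
      arithmetic : ∀ d T → suc (1 + 2 * d + 3 * T + 1) ≡ 1 + 2 * suc d + 3 * T
      arithmetic = solve-∀
    ... | false = begin
      suc (time later + suc (time (explore k rows v t (value later)) + 0))
        ≤⟨ s≤s (ℕₚ.+-mono-≤ (branches-time k p v s rest)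
             (s≤s (ℕₚ.+-monoˡ-≤ 0 (explore-time k v t (value later))))) ⟩
      suc (1 + 2 * length s + 3 * T + suc (3 * (weight t + T′) + 0))
        ≡⟨ arithmetic (length s) T (weight t) T′ ⟩
      1 + 2 * suc (length s) + 3 * (weight t + (T′ + T))
        ≡⟨ ≡.cong (λ z → 1 + 2 * suc (length s) + 3 * (weight t + z)) (≡.trans
             (≡.sym (total-++ weight (targets (tour k v t)) _))
             (≡.cong (total weight) (≡.sym (map-++ target (tour k v t) _)))) ⟩
      1 + 2 * suc (length s) + 3 * (weight t + total weight (targets (tour k v t ++ tours k p v s))) ∎
      where
      open ℕₚ.≤-Reasoning
      later = branches k rows p v s rest
      T  = total weight (targets (tours k p v s))
      T′ = total weight (targets (tour k v t))
      arithmetic : ∀ d T w T′ → suc (1 + 2 * d + 3 * T + suc (3 * (w + T′) + 0)) ≡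
                   1 + 2 * suc d + 3 * (w + (T′ + T))
      arithmetic = solve-∀

  traverse-time : ∀ v → time (traverse rows v) ≤ 3 * total weight (visited v)
  traverse-time v = explore-time n v v []

  ∈-tours⁺ : ∀ k p v {s t a w} → (t , a) ∈ˡ s → t ≢ p → w ∈ˡ t ∷ targets (tour k v t) →
             w ∈ˡ targets (tours k p v s)
  ∈-tours⁺ k p v {(t , _) ∷ s} (here ≡.refl) t≢p w∈
    rewrite dec-false (t ≟ p) t≢p | map-++ target (tour k v t) (tours k p v s) = ∈-++⁺ˡ w∈
  ∈-tours⁺ k p v {(t′ , _) ∷ s} (there ta∈) t≢p w∈ with does (t′ ≟ p)
  ... | true  = ∈-tours⁺ k p v ta∈ t≢p w∈
  ... | false rewrite map-++ target (tour k v t′) (tours k p v s) =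
    there (∈-++⁺ʳ (targets (tour k v t′)) (∈-tours⁺ k p v ta∈ t≢p w∈))

  ∈-tours⁻ : ∀ k p v s {w} → w ∈ˡ targets (tours k p v s) →
             ∃ λ t → t ∈ˡ map proj₁ s × t ≢ p × w ∈ˡ t ∷ targets (tour k v t)
  ∈-tours⁻ k p v ((t , a) ∷ s) w∈ with t ≟ p
  ... | yes _ = let t′ , t′∈ , rest = ∈-tours⁻ k p v s w∈ in t′ , there t′∈ , rest
  ... | no t≢p rewrite map-++ target (tour k v t) (tours k p v s)
    with ∈-++⁻ (t ∷ targets (tour k v t)) w∈
  ... | inj₁ w∈t = t , here ≡.refl , t≢p , w∈t
  ... | inj₂ w∈s = let t′ , t′∈ , rest = ∈-tours⁻ k p v s w∈s in t′ , there t′∈ , rest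

  -- The walk continues to a child t′ of t other than v and, by induction, avoids t from there on.
  -- If it met v, then t′ and v would be neighbours of t joined by a walk avoiding t, contrary to
  -- `branch-unique`.
  descend : ∀ k {v t w} → v ~ t → w ∈ˡ t ∷ targets (tour k v t) →
            ∃ λ (p : Walk F t w) → v ∉ˡ vertices F p
  descend k       {v} {t} e (here ≡.refl) = [] , λ { (here ≡.refl) → irrefl ≡.refl e }
  descend (suc k) {v} {t} {w} e (there w∈) with ∈-tours⁻ k v t (row t) w∈
  ... | t′ , t′∈ , t′≢v , w∈t′ with descend k (key⇒edge t′∈) w∈t′
  ... | q , t∉q = key⇒edge t′∈ ∷ q , avoids
    where
    avoids : v ∉ˡ t ∷ vertices F q
    avoids (here ≡.refl) = irrefl ≡.refl e
    avoids (there v∈q) with split q v∈q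
    ... | q₁ , q₂ , ≡.refl =
      t′≢v (branch-unique forest (key⇒edge t′∈) (symm e) q₁ (t∉q ∘ prefix⊆ q₁ q₂))

  branch-walk : ∀ k {p v w} → w ∈ˡ targets (tour k p v) →
                ∃ λ t → t ∈ˡ map proj₁ (row v) × ∃ λ (q : Walk F t w) → v ∉ˡ vertices F q
  branch-walk (suc k) {p} {v} w∈ with ∈-tours⁻ k p v (row v) w∈
  ... | t , t∈ , _ , w∈t = t , t∈ , descend k (key⇒edge t∈) w∈t

  mutual
    -- Walks into the branches of v avoid v, so v does not recur. A vertex common to two branches
    -- would join two neighbours of v by a walk avoiding v.
    tour-unique : ∀ k p v → Unique (v ∷ targets (tour k p v))
    tour-unique k p v = ¬Any⇒All¬ _ v∉ ∷ targets-unique k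
      where
      v∉ : v ∉ˡ targets (tour k p v)
      v∉ v∈ with branch-walk k v∈
      ... | _ , _ , q , v∉q = v∉q (end∈ q)

      targets-unique : ∀ k → Unique (targets (tour k p v))
      targets-unique zero    = []
      targets-unique (suc k) = tours-unique k p v (row v) (proj₁ (proj₁ (form v))) key⇒edge

    tours-unique : ∀ k p v s → Unique (map proj₁ s) → (∀ {t} → t ∈ˡ map proj₁ s → v ~ t) →
                   Unique (targets (tours k p v s))
    tours-unique k p v []            _           _     = []
    tours-unique k p v ((t , a) ∷ s) (t∉ ∷ uniq) edges with does (t ≟ p)
    ... | true  = tours-unique k p v s uniq (edges ∘ there)
    ... | false rewrite map-++ target (tour k v t) (tours k p v s) =
      ++⁺ (tour-unique k v t) (tours-unique k p v s uniq (edges ∘ there)) disjoint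
      where
      disjoint : ∀ {w} → ¬ (w ∈ˡ t ∷ targets (tour k v t) × w ∈ˡ targets (tours k p v s))
      disjoint (w∈t , w∈s) with descend k (edges (here ≡.refl)) w∈t | ∈-tours⁻ k p v s w∈s
      ... | q , v∉q | t′ , t′∈ , _ , w∈t′ with descend k (edges (there t′∈)) w∈t′
      ... | q′ , v∉q′ = All.lookup t∉ t′∈
        (branch-unique forest (edges (here ≡.refl)) (edges (there t′∈)) (q ++ʷ reverseʷ q′)
          (∉-++ʷ q (reverseʷ q′) v∉q (reverse-∉ q′ v∉q′)))

  visited-unique : ∀ v → Unique (visited v)
  visited-unique v = tour-unique n v v

  -- The condition on p says that the path never needs the edge that the traversal skips. It holds
  -- at a root, which is its own parent, and it is passed on to t because the rest of the path does
  -- not return to v.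
  tour-complete : ∀ k {p v w} (q : Walk F v w) → Unique (vertices F q) → edgeCount F q ≤ k →
                  (p ∈ˡ vertices F q → p ≡ v) → w ∈ˡ v ∷ targets (tour k p v)
  tour-complete k       []      _           _         _   = here ≡.refl
  tour-complete (suc k) {p} {v} (_∷_ {t = t} e q) (v∉q ∷ uniq) (s≤s q≤k) p≡v with ∈-map⁻ proj₁ (edge⇒key e)
  ... | _ , ta∈ , ≡.refl = there (∈-tours⁺ k p v ta∈ t≢p
    (tour-complete k q uniq q≤k λ v∈q → contradiction v∈q (All¬⇒¬Any v∉q)))
    where
    t≢p : t ≢ p
    t≢p ≡.refl = All.lookup v∉q (start∈ q) (≡.sym (p≡v (there (start∈ q))))

  visited⇔connected : ∀ v w → w ∈ˡ visited v ⇔ Connected F v w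
  visited⇔connected v w = mk⇔ to from
    where
    to : w ∈ˡ visited v → Connected F v w
    to (here ≡.refl) = []
    to (there w∈) with branch-walk n w∈
    ... | _ , t∈ , q , _ = key⇒edge t∈ ∷ q

    from : Connected F v w → w ∈ˡ visited v
    from p with toPath forest p
    ... | q , uniq = tour-complete n q uniq
      -- The path has distinct vertices, at most n of them and one more than it has edges, so the
      -- depth n is never exhausted.
      (ℕₚ.≤-trans (ℕₚ.n≤1+n _) (≡.subst (_≤ n) (length-vertices q) (length-unique uniq))) end
      where
      end : v ∈ˡ vertices F q → v ≡ v
      end _ = ≡.refl

-- Computing the entries of D along a traversal.

module Propagation {c ℓ} (K : Field c ℓ) {n : ℕ} (F : Graph n) (forest : IsForest F)
                 (M : Linear.Matrix K n) (M∈ : Linear._∈𝓜₀_ K M F)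
                 (rows : Algorithm.SparseMatrix K n) (form : Algorithm.IsSparseFormOf K rows M)
                 (S : Subset n) (S≡supp : ∀ u → Vec.lookup S u ≡ does (Linear.supp? K M u)) where
  open Field K hiding (zero; _+_) renaming (_*_ to _·_)
  open import Data.Nat using (_+_; _*_)
  open Linear K
  open Algorithm K
  open Cost
  open FieldProperties K
  open Graph F
  open Forests F
  open Supports K F forest
  open Diagonal K F forest M M∈
  open Traversal K F forest M M∈ rows form

  -- The property of preorder that propagation relies on: an edge is listed only after its source
  -- has received its final value.
  data Ordered (known : List (Fin n)) : List Edge → Set (c ⊔ ℓ) where
    []  : Ordered known []
    _∷_ : ∀ {u t a es} → u ∈ˡ known × u ~ t × a ≈ M u t → Ordered (t ∷ known) es →
          Ordered known ((u , t , a) ∷ es)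

  -- The second list is required to be ordered for every larger set of known vertices, which avoids
  -- naming those that the first list adds.
  Ordered-++ : ∀ {known es es′} → Ordered known es →
               (∀ {known′} → known ⊆ˡ known′ → Ordered known′ es′) → Ordered known (es ++ es′)
  Ordered-++ []       later = later id
  Ordered-++ (e ∷ es) later = e ∷ Ordered-++ es λ known⊆ → later (known⊆ ∘ there)

  mutual
    tour-ordered : ∀ k p v {known} → v ∈ˡ known → Ordered known (tour k p v)
    tour-ordered zero    p v v∈ = []
    tour-ordered (suc k) p v v∈ = tours-ordered k p v (row v) id v∈

    tours-ordered : ∀ k p v s {known} → s ⊆ˡ row v → v ∈ˡ known → Ordered known (tours k p v s)
    tours-ordered k p v []            s⊆ v∈ = []
    tours-ordered k p v ((t , a) ∷ s) s⊆ v∈ with does (t ≟ p)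
    ... | true  = tours-ordered k p v s (s⊆ ∘ there) v∈
    ... | false = (v∈ , key⇒edge (∈-map⁺ proj₁ (s⊆ (here ≡.refl))) , entry-value (s⊆ (here ≡.refl))) ∷
      Ordered-++ (tour-ordered k v t (here ≡.refl))
        λ known⊆ → tours-ordered k p v s (s⊆ ∘ there) (known⊆ (there v∈))

  coefficient-value : ∀ (s : SparseVect n) u → value (coefficient s u) ≡ ⟦ s ⟧ u
  coefficient-value []            u = ≡.refl
  coefficient-value ((w , a) ∷ s) u with does (w ≟ u)
  ... | true  = ≡.refl
  ... | false = coefficient-value s u

  coefficient-time : ∀ (s : SparseVect n) u → time (coefficient s u) ≤ 1 + 2 * length s
  coefficient-time []            u = s≤s z≤n
  coefficient-time ((w , a) ∷ s) u with does (w ≟ u)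
  ... | true  = s≤s (s≤s z≤n)
  ... | false = ℕₚ.≤-trans (s≤s (s≤s (coefficient-time s u))) (ℕₚ.≤-reflexive (arithmetic (length s)))
    where
    arithmetic : ∀ d → suc (suc (1 + 2 * d)) ≡ 1 + 2 * suc d
    arithmetic = solve-∀

  -- The number that `propagate` writes at t, isolated from the bookkeeping of costs.
  relax : Vec Carrier n → Edge → Carrier
  relax d (u , t , a) = y
    where
    x = if Vec.lookup S u then Vec.lookup d u · value (coefficient (row t) u) ⁻¹ else Vec.lookup d u
    y = if Vec.lookup S t then x · a else x

  propagate-value : ∀ u t a es d → value (propagate rows S ((u , t , a) ∷ es) d) ≡
                    value (propagate rows S es (d Vec.[ t ]≔ relax d (u , t , a)))
  propagate-value u t a es d with Vec.lookup S u | Vec.lookup S t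
  ... | true  | true  = ≡.refl
  ... | true  | false = ≡.refl
  ... | false | true  = ≡.refl
  ... | false | false = ≡.refl

  relax-factor : ∀ d {u t a} → u ~ t → a ≈ M u t → relax d (u , t , a) ≈ Vec.lookup d u · factor u t
  relax-factor d {u} {t} {a} e a≈
    rewrite S≡supp u | S≡supp t | coefficient-value (row t) u with does (supp? M u) | does (supp? M t)
  ... | true  | true  = trans (*-cong (*-congˡ inverse) a≈) (*-assoc _ _ _)
    -- The entry found in row t agrees with M t u only up to `_≈_`, so inverting it requires that M
    -- t u is nonzero, which the edge provides.
    where
    inverse : ⟦ row t ⟧ u ⁻¹ ≈ M t u ⁻¹
    inverse = sym (⁻¹-cong (entry-nonzero M∈ (symm e)) (sym (proj₂ (form t) u)))
  ... | true  | false = *-congˡ (trans inverse (sym (*-identityʳ _)))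
    where
    inverse : ⟦ row t ⟧ u ⁻¹ ≈ M t u ⁻¹
    inverse = sym (⁻¹-cong (entry-nonzero M∈ (symm e)) (sym (proj₂ (form t) u)))
  ... | false | true  = *-congˡ (trans a≈ (sym (*-identityˡ _)))
  ... | false | false = sym (trans (*-congˡ (*-identityˡ 1#)) (*-identityʳ _))

  -- An edge into t costs at most ten steps apart from the cells passed in row t during the search
  -- for M t u, which cost two each. Both are covered by ten times the weight of t.
  propagate-time : ∀ es d → time (propagate rows S es d) ≤ 1 + 10 * total weight (targets es)
  propagate-time []                 d = s≤s z≤n
  propagate-time ((u , t , a) ∷ es) d = step
    where
    open ℕₚ.≤-Reasoning
    l = length (row t)
    T = total weight (targets es)

    arithmetic : ∀ l T → 3 + (1 + (1 + 2 * l + 2) + (1 + (1 + (1 + (1 + 10 * T))))) + 8 * l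
                 ≡ 1 + 10 * (suc l + T)
    arithmetic = solve-∀

    bound : ∀ {x y r} → x ≤ 1 + (1 + 2 * l + 2) → y ≤ 1 → r ≤ 1 + 10 * T →
            3 + (x + (1 + (y + (1 + r)))) ≤ 1 + 10 * (suc l + T)
    bound {x} {y} {r} x≤ y≤ r≤ = begin
      3 + (x + (1 + (y + (1 + r))))
        ≤⟨ ℕₚ.+-monoʳ-≤ 3 (ℕₚ.+-mono-≤ x≤ (s≤s (ℕₚ.+-mono-≤ y≤ (s≤s r≤)))) ⟩
      3 + (1 + (1 + 2 * l + 2) + (1 + (1 + (1 + (1 + 10 * T)))))
        ≤⟨ ℕₚ.m≤m+n _ (8 * l) ⟩
      3 + (1 + (1 + 2 * l + 2) + (1 + (1 + (1 + (1 + 10 * T))))) + 8 * l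
        ≡⟨ arithmetic l T ⟩
      1 + 10 * (suc l + T) ∎

    divide : Bool → Carrier → Timed Carrier
    divide b dᵤ = if b then (do row ← rows ! t
                                b   ← coefficient row u
                                b⁻¹ ← invert {n} b
                                multiply {n} dᵤ b⁻¹) else return dᵤ

    divide-time : ∀ b x → time (divide b x) ≤ 1 + (1 + 2 * l + 2)
    divide-time true  x = s≤s (ℕₚ.+-monoˡ-≤ 2 (coefficient-time (row t) u))
    divide-time false x = z≤n

    scale-time : ∀ b (x : Carrier) → time (if b then multiply {n} x a else return x) ≤ 1
    scale-time true  x = s≤s z≤n
    scale-time false x = z≤n

    step : time (propagate rows S ((u , t , a) ∷ es) d) ≤ 1 + 10 * (suc l + T)
    step = bound (divide-time (Vec.lookup S u) _) (scale-time (Vec.lookup S t) _) (propagate-time es _)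

  module _ (D : Vect n) where

    Good : Vec Carrier n → Fin n → Set ℓ
    Good d w = Vec.lookup d w ≈ D w

    module _ {C : Fin n → Set} (C-step : ∀ {u t} → C u → u ~ t → C t)
             (D-step : ∀ {u t} → C u → u ~ t → D t ≈ D u · factor u t) where

      -- A value written at t is correct because that at u is, and therefore correct entries stay
      -- correct even when overwritten. Membership in `C` is carried along since `D-step` is
      -- available only there.
      propagate-good : ∀ {known es} d → Ordered known es →
        (∀ {w} → w ∈ˡ known → C w × Good d w) →
        ∀ {w} → Good d w ⊎ w ∈ˡ targets es → Good (value (propagate rows S es d)) w
      propagate-good d [] _ (inj₁ good) = good
      propagate-good {known} d (_∷_ {u} {t} {a} {es} (u∈ , e , a≈) ordered) good {w} w-ok
        rewrite propagate-value u t a es d = propagate-good d′ ordered good′ (w-ok′ w-ok)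
        where
        d′ = d Vec.[ t ]≔ relax d (u , t , a)

        good-t : Good d′ t
        good-t = trans (reflexive (Vecₚ.lookup∘updateAt t d)) (trans (relax-factor d e a≈)
          (trans (*-congʳ (proj₂ (good u∈))) (sym (D-step (proj₁ (good u∈)) e))))

        preserve : ∀ {w} → Good d w → Good d′ w
        preserve {w} good-w with w ≟ t
        ... | yes ≡.refl = good-t
        ... | no w≢t     = trans (reflexive (Vecₚ.lookup∘updateAt′ w t w≢t d)) good-w

        good′ : ∀ {w} → w ∈ˡ t ∷ known → C w × Good d′ w
        good′ (here ≡.refl) = C-step (proj₁ (good u∈)) e , good-t
        good′ (there w∈)    = proj₁ (good w∈) , preserve (proj₂ (good w∈))

        w-ok′ : Good d w ⊎ w ∈ˡ t ∷ targets es → Good d′ w ⊎ w ∈ˡ targets es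
        w-ok′ (inj₁ good-w)         = inj₁ (preserve good-w)
        w-ok′ (inj₂ (here ≡.refl))  = inj₁ good-t
        w-ok′ (inj₂ (there w∈))     = inj₂ w∈

module _ {a b} {X : Set a} {Y : Set b} (f : X → Timed Y) where
  open Cost
  open import Data.Nat using (_+_)

  mapList-value : ∀ xs → value (mapList f xs) ≡ map (value ∘ f) xs
  mapList-value []       = ≡.refl
  mapList-value (x ∷ xs) = ≡.cong (value (f x) ∷_) (mapList-value xs)

  mapList-time : ∀ xs → time (mapList f xs) ≡ suc (total (suc ∘ time ∘ f) xs)
  mapList-time []       = ≡.refl
  mapList-time (x ∷ xs) = ≡.cong suc (≡.trans
    (≡.cong (time (f x) +_) (≡.trans (ℕₚ.+-identityʳ _) (mapList-time xs)))
    (ℕₚ.+-suc (time (f x)) _))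

  mapArray-value : ∀ {n} (xs : Vec X n) → value (mapArray f xs) ≡ Vec.map (value ∘ f) xs
  mapArray-value []       = ≡.refl
  mapArray-value (x ∷ xs) = ≡.cong (value (f x) ∷_) (mapArray-value xs)

  mapArray-time : ∀ {n} (xs : Vec X n) →
                  time (mapArray f xs) ≡ suc (total (λ u → suc (time (f (Vec.lookup xs u)))) (allFin n))
  mapArray-time xs = ≡.trans (go xs)
    (≡.cong suc (≡.sym (total-allFin λ u → suc (time (f (Vec.lookup xs u))))))
    where
    go : ∀ {n} (xs : Vec X n) → time (mapArray f xs) ≡
         suc (MonoidSum.sum ℕₚ.+-0-commutativeMonoid λ u → suc (time (f (Vec.lookup xs u))))
    go []       = ≡.refl
    go (x ∷ xs) = ≡.cong suc (≡.trans
      (≡.cong (time (f x) +_) (≡.trans (ℕₚ.+-identityʳ _) (go xs)))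
      (ℕₚ.+-suc (time (f x)) _))

-- Connected components and the choice of a support vertex in each.

module Components {c ℓ} (K : Field c ℓ) {n : ℕ} (F : Graph n) (forest : IsForest F)
                 (M : Linear.Matrix K n) (M∈ : Linear._∈𝓜₀_ K M F)
                 (rows : Algorithm.SparseMatrix K n) (form : Algorithm.IsSparseFormOf K rows M) where
  open Algorithm K
  open Cost
  open import Data.Nat using (_+_; _*_)
  open Graph F
  open Forests F
  open Traversal K F forest M M∈ rows form

  Spread : List (Fin n) → Set
  Spread = AllPairs λ v w → ¬ Connected F v w

  Reached : List (Fin n) → Fin n → Set
  Reached vs w = Any (λ v → Connected F v w) vs

  spread-single : ∀ {vs} → Spread vs → ∀ {v w} → v ∈ˡ vs → w ∈ˡ vs → Connected F v w → v ≡ w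
  spread-single _                (here ≡.refl) (here ≡.refl) _ = ≡.refl
  spread-single (apart ∷ _)      (here ≡.refl) (there w∈)    p = contradiction p (All.lookup apart w∈)
  spread-single (apart ∷ _)      (there v∈)    (here ≡.refl) p =
    contradiction (reverseʷ p) (All.lookup apart v∈)
  spread-single (_ ∷ spread)     (there v∈)    (there w∈)    p = spread-single spread v∈ w∈ p

  totalVisited : List (Fin n) → ℕ
  totalVisited = total (total weight ∘ visited)

  -- Traversals from vertices in different components visit disjoint sets, each without repetition,
  -- so their concatenation still consists of distinct vertices.
  totalVisited-bound : ∀ {vs} → Spread vs → totalVisited vs ≤ total weight (allFin n)
  totalVisited-bound {vs} spread = begin
    totalVisited vs                    ≡⟨ flatten vs ⟩
    total weight (concatMap visited vs)
      ≤⟨ total-⊆ weight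
           (concat⁺ (All-map⁺ (All.universal visited-unique vs))
                    (AllPairsₚ.map⁺ (AllPairs.map disjoint spread)))
           (λ _ → ∈-allFin _) ⟩
    total weight (allFin n) ∎
    where
    open ℕₚ.≤-Reasoning

    flatten : ∀ vs → totalVisited vs ≡ total weight (concatMap visited vs)
    flatten []       = ≡.refl
    flatten (v ∷ vs) = ≡.trans (≡.cong (total weight (visited v) +_) (flatten vs))
      (≡.sym (total-++ weight (visited v) _))

    disjoint : ∀ {v w} → ¬ Connected F v w → ∀ {x} → ¬ (x ∈ˡ visited v × x ∈ˡ visited w)
    disjoint ¬p (x∈v , x∈w) = ¬p (Equivalence.to (visited⇔connected _ _) x∈v ++ʷ
                                  reverseʷ (Equivalence.to (visited⇔connected _ _) x∈w))

  length≤total : ∀ vs → length vs ≤ total weight vs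
  length≤total vs = ≡.subst (_≤ total weight vs) (≡.sym (length≡total vs)) (total-mono (λ _ → s≤s z≤n) vs)

  markAll-∈ : ∀ vs seen {w} → w ∈ˡ vs ⊎ Vec.lookup seen w ≡ true →
              Vec.lookup (value (markAll {n} vs seen)) w ≡ true
  markAll-∈ []       seen (inj₂ eq) = eq
  markAll-∈ (v ∷ vs) seen {w} w-ok  = markAll-∈ vs (seen Vec.[ v ]≔ true) (step w-ok)
    where
    marked : ∀ {w} → Vec.lookup seen w ≡ true → Vec.lookup (seen Vec.[ v ]≔ true) w ≡ true
    marked {w} eq with w ≟ v
    ... | yes ≡.refl = Vecₚ.lookup∘updateAt v seen
    ... | no w≢v     = ≡.trans (Vecₚ.lookup∘updateAt′ w v w≢v seen) eq

    step : w ∈ˡ v ∷ vs ⊎ Vec.lookup seen w ≡ true → w ∈ˡ vs ⊎ Vec.lookup (seen Vec.[ v ]≔ true) w ≡ true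
    step (inj₁ (here ≡.refl)) = inj₂ (Vecₚ.lookup∘updateAt v seen)
    step (inj₁ (there w∈))    = inj₁ w∈
    step (inj₂ eq)            = inj₂ (marked eq)

  markAll-∉ : ∀ vs seen {w} → w ∉ˡ vs → Vec.lookup (value (markAll {n} vs seen)) w ≡ Vec.lookup seen w
  markAll-∉ []       seen w∉ = ≡.refl
  markAll-∉ (v ∷ vs) seen {w} w∉ = ≡.trans (markAll-∉ vs (seen Vec.[ v ]≔ true) (w∉ ∘ there))
    (Vecₚ.lookup∘updateAt′ w v (w∉ ∘ here) seen)

  markAll-time : ∀ vs seen → time (markAll {n} vs seen) ≡ 1 + 2 * length vs
  markAll-time []       seen = ≡.refl
  markAll-time (v ∷ vs) seen = ≡.trans (≡.cong (2 +_) (markAll-time vs _)) (arithmetic (length vs))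
    where
    arithmetic : ∀ l → 2 + (1 + 2 * l) ≡ 1 + 2 * suc l
    arithmetic = solve-∀

  -- In `duration`, each candidate costs two steps for its cell and the access to `seen`; the 7
  -- combines 3 for the traversal with 4 for listing and marking the component.
  record Roots (vs : List (Fin n)) (seen : Vec Bool n) (result : Timed (List (List (Fin n)))) : Set where
    field
      roots    : List (Fin n)
      listed   : value result ≡ map visited roots
      spread   : Spread roots
      unseen   : All (λ r → Vec.lookup seen r ≢ true) roots
      covering : ∀ {w} → w ∈ˡ vs → Vec.lookup seen w ≡ true ⊎ Reached roots w
      duration : time result ≤ 1 + 2 * length vs + 7 * totalVisited roots

  -- The hypothesis makes the marked vertices a union of components, which persists because a whole
  -- component is marked at a time. Roots found later are unmarked then, so none is connected to v.
  componentsFrom-roots : ∀ vs seen →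
    (∀ {v w} → Vec.lookup seen v ≡ true → Connected F v w → Vec.lookup seen w ≡ true) →
    Roots vs seen (componentsFrom rows vs seen)
  componentsFrom-roots []       seen closed = record
    { roots = [] ; listed = ≡.refl ; spread = [] ; unseen = [] ; covering = λ () ; duration = s≤s z≤n }
  componentsFrom-roots (v ∷ vs) seen closed with Vec.lookup seen v in seen-v
  ... | true = record
    { roots = roots ; listed = listed ; spread = spread ; unseen = unseen
    ; covering = λ { (here ≡.refl) → inj₁ seen-v ; (there w∈) → covering w∈ }
    ; duration = begin
        2 + time (componentsFrom rows vs seen)
          ≤⟨ ℕₚ.+-monoʳ-≤ 2 duration ⟩
        2 + (1 + 2 * length vs + 7 * totalVisited roots)
          ≡⟨ arithmetic (length vs) (totalVisited roots) ⟩
        1 + 2 * suc (length vs) + 7 * totalVisited roots            ∎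
    }
    where
    open ℕₚ.≤-Reasoning
    open Roots (componentsFrom-roots vs seen closed)
    arithmetic : ∀ l T → 2 + (1 + 2 * l + 7 * T) ≡ 1 + 2 * suc l + 7 * T
    arithmetic = solve-∀
  ... | false = record
    { roots = v ∷ roots
    ; listed = ≡.cong₂ _∷_ component≡ listed
    ; spread = All.map (λ r-unseen p → r-unseen (in-seen′ (inj₁ p))) unseen ∷ spread
    ; unseen = (λ seen-v′ → false≢true (≡.trans (≡.sym seen-v) seen-v′)) ∷
               All.map (λ r-unseen r-seen → r-unseen (in-seen′ (inj₂ r-seen))) unseen
    ; covering = λ { (here ≡.refl) → inj₂ (here []) ; (there w∈) → cover (covering w∈) }
    ; duration = begin
        2 + (time (traverse rows v) + (time below + (time (markAll {n} (v ∷ value below) seen) +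
          (time (componentsFrom rows vs seen′) + 0))))
          ≤⟨ ℕₚ.+-monoʳ-≤ 2 (ℕₚ.+-mono-≤ (traverse-time v) (ℕₚ.+-mono-≤
               (ℕₚ.≤-reflexive below-time)
               (ℕₚ.+-mono-≤ (ℕₚ.≤-reflexive (markAll-time (v ∷ value below) seen))
                             (ℕₚ.+-monoˡ-≤ 0 duration)))) ⟩
        2 + (3 * W + (1 + 1 * B + (1 + 2 * length (v ∷ value below) +
          (1 + 2 * length vs + 7 * T + 0))))
          ≡⟨ ≡.cong (λ xs → 2 + (3 * W + (1 + 1 * B + (1 + 2 * length xs +
               (1 + 2 * length vs + 7 * T + 0))))) component≡ ⟩
        2 + (3 * W + (1 + 1 * B + (1 + 2 * suc B +
          (1 + 2 * length vs + 7 * T + 0))))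
          ≤⟨ ℕₚ.m≤m+n _ B ⟩
        2 + (3 * W + (1 + 1 * B + (1 + 2 * suc B +
          (1 + 2 * length vs + 7 * T + 0)))) + B
          ≡⟨ arithmetic (length vs) T W B ⟩
        1 + 2 * suc (length vs) + (3 * W + 4 * suc B + 7 * T)
          ≤⟨ ℕₚ.+-monoʳ-≤ (1 + 2 * suc (length vs)) (ℕₚ.+-monoˡ-≤ (7 * T)
               (ℕₚ.+-monoʳ-≤ (3 * W) (ℕₚ.*-monoʳ-≤ 4 B<W))) ⟩
        1 + 2 * suc (length vs) + (3 * W + 4 * W + 7 * T)
          ≡⟨ arithmetic′ (length vs) T W ⟩
        1 + 2 * suc (length vs) + 7 * (W + T) ∎
    }
    where
    open ℕₚ.≤-Reasoning

    endpoint : Edge → Timed (Fin n)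
    endpoint e = return (target e)

    below = mapList endpoint (value (traverse rows v))
    seen′ = value (markAll {n} (v ∷ value below) seen)

    component≡ : v ∷ value below ≡ visited v
    component≡ = ≡.cong (v ∷_) (≡.trans
      (mapList-value endpoint (value (traverse rows v))) (≡.cong targets (traverse-value v)))

    false≢true : false ≢ true
    false≢true ()

    in-seen′ : ∀ {w} → Connected F v w ⊎ Vec.lookup seen w ≡ true → Vec.lookup seen′ w ≡ true
    in-seen′ {w} (inj₁ p)  = markAll-∈ (v ∷ value below) seen (inj₁ (≡.subst (w ∈ˡ_) (≡.sym component≡)
      (Equivalence.from (visited⇔connected _ _) p)))
    in-seen′ (inj₂ eq) = markAll-∈ (v ∷ value below) seen (inj₂ eq)

    from-seen′ : ∀ {w} → Vec.lookup seen′ w ≡ true → Connected F v w ⊎ Vec.lookup seen w ≡ true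
    from-seen′ {w} eq with connected? forest v w
    ... | yes p = inj₁ p
    ... | no ¬p = inj₂ (≡.trans (≡.sym (markAll-∉ (v ∷ value below) seen
      λ w∈ → ¬p (Equivalence.to (visited⇔connected _ _) (≡.subst (w ∈ˡ_) component≡ w∈)))) eq)

    closed′ : ∀ {u w} → Vec.lookup seen′ u ≡ true → Connected F u w → Vec.lookup seen′ w ≡ true
    closed′ eq q with from-seen′ eq
    ... | inj₁ p   = in-seen′ (inj₁ (p ++ʷ q))
    ... | inj₂ eq′ = in-seen′ (inj₂ (closed eq′ q))

    open Roots (componentsFrom-roots vs seen′ closed′)

    cover : ∀ {w} → Vec.lookup seen′ w ≡ true ⊎ Reached roots w →
            Vec.lookup seen w ≡ true ⊎ Reached (v ∷ roots) w
    cover (inj₂ reached) = inj₂ (there reached)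
    cover (inj₁ eq) with from-seen′ eq
    ... | inj₁ p   = inj₂ (here p)
    ... | inj₂ eq′ = inj₁ eq′

    W = total weight (visited v)
    T = totalVisited roots
    B = length (targets (tour n v v))

    B<W : suc B ≤ W
    B<W = length≤total (visited v)

    below-time : time below ≡ 1 + 1 * B
    below-time = ≡.trans (mapList-time endpoint (value (traverse rows v)))
      (≡.cong suc (≡.trans (total-const 1 (value (traverse rows v))) (≡.cong (1 *_)
        (≡.trans (≡.cong length (traverse-value v)) (≡.sym (length-map target (tour n v v)))))))

    arithmetic : ∀ l T W B → 2 + (3 * W + (1 + 1 * B + (1 + 2 * suc B +
      (1 + 2 * l + 7 * T + 0)))) + B ≡
      1 + 2 * suc l + (3 * W + 4 * suc B + 7 * T)
    arithmetic = solve-∀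

    arithmetic′ : ∀ l T W → 1 + 2 * suc l + (3 * W + 4 * W + 7 * T) ≡
      1 + 2 * suc l + 7 * (W + T)
    arithmetic′ = solve-∀

  components-roots : Roots (allFin n) (Vec.replicate n false)
                           (componentsFrom rows (allFin n) (Vec.replicate n false))
  components-roots = componentsFrom-roots (allFin n) (Vec.replicate n false) λ {v} eq →
    contradiction (≡.trans (≡.sym (Vecₚ.lookup-replicate v false)) eq) λ ()

  module _ (S : Subset n) where

    In : Fin n → Set
    In w = Vec.lookup S w ≡ true

    chooseIn-value : ∀ vs → (∃ λ u → value (chooseIn S vs) ≡ just u × u ∈ˡ vs × In u) ⊎
                            (value (chooseIn S vs) ≡ nothing × All (¬_ ∘ In) vs)
    chooseIn-value []       = inj₂ (≡.refl , [])
    chooseIn-value (v ∷ vs) with Vec.lookup S v in eq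
    ... | true  = inj₁ (v , ≡.refl , here ≡.refl , eq)
    ... | false with chooseIn-value vs
    ... | inj₁ (u , eq-u , u∈ , u∈S) = inj₁ (u , eq-u , there u∈ , u∈S)
    ... | inj₂ (eq-vs , vs∉S)        = inj₂
      (eq-vs , (λ v∈S → contradiction (≡.trans (≡.sym eq) v∈S) λ ()) ∷ vs∉S)

    chooseIn-time : ∀ vs → time (chooseIn S vs) ≤ 1 + 2 * length vs
    chooseIn-time []       = s≤s z≤n
    chooseIn-time (v ∷ vs) with Vec.lookup S v
    ... | true  = s≤s (s≤s z≤n)
    ... | false = ℕₚ.≤-trans (s≤s (s≤s (chooseIn-time vs))) (ℕₚ.≤-reflexive (arithmetic (length vs)))
      where
      arithmetic : ∀ l → 2 + (1 + 2 * l) ≡ 1 + 2 * suc l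
      arithmetic = solve-∀

    record Choice (roots us : List (Fin n)) : Set where
      field
        inside   : All In us
        reached  : All (Reached roots) us
        spread   : Spread us
        covering : ∀ {w} → In w → Reached roots w → Reached us w

    -- A chosen vertex lies in the component of its root and inherits the separation of the roots.
    -- When `chooseIn` finds nothing, that component contains no vertex of S that would have to be
    -- covered.
    choose-choice : ∀ {roots} → Spread roots → Choice roots (value (choose S (map visited roots)))
    choose-choice {[]}        _                =
      record { inside = [] ; reached = [] ; spread = [] ; covering = λ _ () }
    choose-choice {r ∷ roots} (apart ∷ spread)
      with value (chooseIn S (visited r)) | chooseIn-value (visited r) | choose-choice spread
    ... | just u | inj₁ (.u , ≡.refl , u∈r , u∈S) | later = record
      { inside   = u∈S ∷ Choice.inside later
      ; reached  = here r→u ∷ All.map there (Choice.reached later)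
      ; spread   = All.map isolate (Choice.reached later) ∷ Choice.spread later
      ; covering = λ
          { _   (here r→w) → here (reverseʷ r→u ++ʷ r→w)
          ; w∈S (there w)  → there (Choice.covering later w∈S w) }
      }
      where
      r→u : Connected F r u
      r→u = Equivalence.to (visited⇔connected r u) u∈r

      isolate : ∀ {w} → Reached roots w → ¬ Connected F u w
      isolate reached u→w = All¬⇒¬Any apart (Any.map (λ s→w → (r→u ++ʷ u→w) ++ʷ reverseʷ s→w) reached)
    ... | nothing | inj₂ (_ , r∉S) | later = record
      { inside   = Choice.inside later
      ; reached  = All.map there (Choice.reached later)
      ; spread   = Choice.spread later
      ; covering = λ
          { w∈S (here r→w) → contradiction w∈S (All.lookup r∉S (Equivalence.from (visited⇔connected r _) r→w))
          ; w∈S (there w)  → Choice.covering later w∈S w }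
      }

    choose-time : ∀ roots → time (choose S (map visited roots)) ≤ 1 + 4 * totalVisited roots
    choose-time []          = s≤s z≤n
    choose-time (r ∷ roots) = begin
      suc (time (chooseIn S (visited r)) + (time (choose S (map visited roots)) + 0))
        ≤⟨ s≤s (ℕₚ.+-mono-≤ (chooseIn-time (visited r)) (ℕₚ.+-monoˡ-≤ 0 (choose-time roots))) ⟩
      suc (1 + 2 * suc B + (1 + 4 * T + 0))
        ≤⟨ ℕₚ.m≤m+n _ (2 * B) ⟩
      suc (1 + 2 * suc B + (1 + 4 * T + 0)) + 2 * B
        ≡⟨ arithmetic B T ⟩
      1 + 4 * (suc B + T)
        ≤⟨ s≤s (ℕₚ.*-monoʳ-≤ 4 (ℕₚ.+-monoˡ-≤ T (length≤total (visited r)))) ⟩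
      1 + 4 * (total weight (visited r) + T) ∎
      where
      open ℕₚ.≤-Reasoning
      B = length (targets (tour n r r))
      T = totalVisited roots
      arithmetic : ∀ B T → suc (1 + 2 * suc B + (1 + 4 * T + 0)) + 2 * B ≡ 1 + 4 * (suc B + T)
      arithmetic = solve-∀

-- `IsChoice` and `Dᵁ` speak of subsets, whereas the procedure holds the chosen vertices in a list.
fromList : ∀ {n} → List (Fin n) → Subset n
fromList vs = Vec.tabulate λ w → does (w ∈ˡ? vs)
  where open DecMembership _≟_ using () renaming (_∈?_ to _∈ˡ?_)

∈-fromList : ∀ {n} {vs : List (Fin n)} {w} → w ∈ fromList vs ⇔ w ∈ˡ vs
∈-fromList {vs = vs} {w} = mk⇔
  (λ w∈ → from-does (≡.trans (≡.sym (Vecₚ.lookup∘tabulate _ w)) (Vecₚ.[]=⇒lookup w∈)))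
  (λ w∈ → Vecₚ.lookup⇒[]= w _ (≡.trans (Vecₚ.lookup∘tabulate _ w) (dec-true (w ∈ˡ? vs) w∈)))
  where
  open DecMembership _≟_ using () renaming (_∈?_ to _∈ˡ?_)
  from-does : does (w ∈ˡ? vs) ≡ true → w ∈ˡ vs
  from-does eq with w ∈ˡ? vs
  ... | yes w∈ = w∈

-- Bases given by lists of sparse vectors.

module BasisVectors {c ℓ} (K : Field c ℓ) where
  open Field K renaming (zero to *-zero)
  open Linear K
  open Algorithm K
  open LinearProperties K
  open SparseVectors K

  -- The row `Identity i`, used as coefficients, would otherwise be a nontrivial relation. This
  -- excludes empty lists in the basis, whose processing time would not be paid for by any entry.
  basis-nonzero : ∀ {n k} {W : Vect n → Set ℓ} {b : Fin k → Vect n} → IsBasis W b →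
                  ∀ i → ¬ (∀ u → b i u ≈ 0#)
  basis-nonzero {b = b} (_ , independent , _) i bi≈0 =
    1≉0 (trans (sym (diag-diagonal (λ _ → 1#) i)) (independent (Identity i) vanishes i))
    where
    vanishes : ∀ u → combination (Identity i) b u ≈ 0#
    vanishes u = trans (diag-*ᵥ (λ _ → 1#) (λ j → b j u) i) (trans (*-congˡ (bi≈0 u)) (zeroʳ 1#))

  -- The rescaled list has the length of the original one only propositionally, so its index type
  -- must be transported.
  basis-reindex : ∀ {n k k′} {W : Vect n → Set ℓ} {b : Fin k → Vect n} (eq : k′ ≡ k) →
                  IsSparsestBasis W b → IsSparsestBasis W (b ∘ ≡.subst Fin eq)
  basis-reindex ≡.refl sparsest = sparsest

  nnzFamily-reduced : ∀ {n} {B : List (SparseVect n)} → All IsReduced B → nnzFamily ⟦ B ⟧* ≡ total length B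
  nnzFamily-reduced {B = B} reduced =
    ≡.trans (sum-lookup (λ s → nnz ⟦ s ⟧) B) (total-cong (All.map nnz-reduced reduced))

-- Correctness and running time of the whole procedure.

module Procedure {c ℓ} (K : Field c ℓ) {n : ℕ} (F : Graph n) (forest : IsForest F)
                 (M : Linear.Matrix K n) (M∈ : Linear._∈𝓜₀_ K M F)
                 (rows : Algorithm.SparseMatrix K n) (form : Algorithm.IsSparseFormOf K rows M) where
  open Field K hiding (zero; _+_) renaming (_*_ to _·_)
  open import Data.Nat using (_+_; _*_)
  open Linear K
  open Algorithm K
  open Cost
  open FieldProperties K
  open LinearProperties K
  open SparseVectors K
  open BasisVectors K
  open Graph F
  open Forests F
  open Supports K F forest
  open Diagonal K F forest M M∈
  open Traversal K F forest M M∈ rows form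
  open Components K F forest M M∈ rows form

  adjacency : AdjacencyLists n
  adjacency = value (findForest rows)

  adjacency-row : ∀ u → Vec.lookup adjacency u ≡ map proj₁ (row u)
  adjacency-row u = ≡.trans
    (≡.cong (λ xs → Vec.lookup xs u) (mapArray-value _ rows))
    (≡.trans (Vecₚ.lookup-map u _ rows) (mapList-value _ (row u)))

  adjacency-correct : IsAdjacencyListsOf adjacency F
  adjacency-correct u rewrite adjacency-row u =
    proj₁ (proj₁ (form u)) , λ w → mk⇔ key⇒edge edge⇒key

  totalWeight : total weight (allFin n) ≡ n + nnzFamily M
  totalWeight = ≡.trans (total-suc (length ∘ row) (allFin n))
    (≡.cong₂ ℕ._+_ (length-tabulate id) (≡.trans (total-allFin (length ∘ row))
      (MonoidSum.sum-cong-≗ ℕₚ.+-0-commutativeMonoid row-length)))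
    where
    row-length : ∀ u → length (row u) ≡ nnz (M u)
    row-length u = ≡.trans (≡.sym (nnz-reduced (proj₁ (form u)))) (nnz-cong λ w →
      mk⇔ (trans (sym (proj₂ (form u) w))) (trans (proj₂ (form u) w)))

  findForest-time : time (findForest rows) ≤ 1 + 2 * total weight (allFin n)
  findForest-time = begin
    time (findForest rows)                    ≡⟨ mapArray-time _ rows ⟩
    suc (total (suc ∘ rowTime) (allFin n))    ≤⟨ s≤s (total-mono row-bound (allFin n)) ⟩
    suc (total (λ u → 2 * weight u) (allFin n)) ≡⟨ ≡.cong suc (total-* 2 weight (allFin n)) ⟩
    1 + 2 * total weight (allFin n)       ∎
    where
    open ℕₚ.≤-Reasoning

    rowTime : Fin n → ℕ
    rowTime u = time (mapList (λ (w , _) → return w) (row u))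

    row-bound : ∀ u → suc (rowTime u) ≤ 2 * weight u
    row-bound u = begin
      suc (rowTime u)                        ≡⟨ ≡.cong suc (mapList-time _ (row u)) ⟩
      2 + total (λ _ → 1) (row u)          ≡⟨ ≡.cong (2 +_) (≡.sym (length≡total (row u))) ⟩
      2 + length (row u)                   ≤⟨ ℕₚ.m≤m+n _ _ ⟩
      2 + length (row u) + length (row u) ≡⟨ arithmetic (length (row u)) ⟩
      2 * weight u                         ∎
      where
      arithmetic : ∀ l → 2 + l + l ≡ 2 * suc l
      arithmetic = solve-∀

  module _ (S : Subset n) (S-correct : ∀ w → w ∈ S ⇔ Supp (A F) w) where

    In⇔Supp : ∀ {w} → In S w ⇔ Supp (A F) w
    In⇔Supp {w} = mk⇔ (Equivalence.to (S-correct w) ∘ Vecₚ.lookup⇒[]= w S)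
                      (Vecₚ.[]=⇒lookup ∘ Equivalence.from (S-correct w))

    -- The known algorithm delivers the support of A(F) while D is defined by that of M; `transfer`
    -- in both directions identifies them.
    S≡supp : ∀ u → Vec.lookup S u ≡ does (supp? M u)
    S≡supp u with supp? M u
    ... | yes u∈M = Equivalence.from In⇔Supp (proj₁ (transfer A∈𝓜₀ M∈ u∈M))
    ... | no u∉M with Vec.lookup S u in eq
    ... | true  = contradiction (proj₁ (transfer M∈ A∈𝓜₀ (Equivalence.to In⇔Supp eq))) u∉M
    ... | false = ≡.refl

    choice-correct : ∀ {roots us} → (∀ w → Reached roots w) → Choice S roots us → IsChoice F (fromList us)
    choice-correct {roots} {us} reachable choice = record
      { chosen = λ v∈U → restrict A∈𝓜₀
          (Equivalence.to In⇔Supp (All.lookup inside (Equivalence.to ∈-fromList v∈U)))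
      ; single = λ v∈U w∈U →
          spread-single spread (Equivalence.to ∈-fromList v∈U) (Equivalence.to ∈-fromList w∈U)
      ; every  = every
      }
      where
      open Choice choice

      every : ∀ v {w} → SuppOn (Connected F v) (A F) w → ∃ λ u → u ∈ fromList us × Connected F v u
      every v {w} w∈@(v→w , _)
        with find (covering (Equivalence.from In⇔Supp (extend A∈𝓜₀ w∈)) (reachable w))
      ... | u , u∈us , u→w = u , Equivalence.from ∈-fromList u∈us , v→w ++ʷ reverseʷ u→w

    open Propagation K F forest M M∈ rows form S S≡supp

    propagateFrom-time : ∀ us d → time (propagateFrom rows S us d) ≤ 1 + 15 * totalVisited us
    propagateFrom-time []       d = s≤s z≤n
    propagateFrom-time (u ∷ us) d = begin
      suc (time (traverse rows u) + (time (propagate rows S (value (traverse rows u)) d) +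
        time (propagateFrom rows S us d′)))
        ≤⟨ s≤s (ℕₚ.+-mono-≤ (traverse-time u) (ℕₚ.+-mono-≤
             (propagate-time (value (traverse rows u)) d) (propagateFrom-time us d′))) ⟩
      suc (3 * suc (l + W₁) + (1 + 10 * total weight (targets (value (traverse rows u))) + (1 + 15 * T)))
        ≡⟨ ≡.cong (λ es → suc (3 * suc (l + W₁) + (1 + 10 * total weight (targets es) + (1 + 15 * T))))
             (traverse-value u) ⟩
      suc (3 * suc (l + W₁) + (1 + 10 * W₁ + (1 + 15 * T)))
        -- Traversal contributes 3 and propagation 10 per unit of weight below the root; the
        -- remainder of 15 is slack, and the weight of the root itself absorbs the fixed overhead.
        ≤⟨ ℕₚ.m≤m+n _ (10 + 12 * l + 2 * W₁) ⟩
      suc (3 * suc (l + W₁) + (1 + 10 * W₁ + (1 + 15 * T))) + (10 + 12 * l + 2 * W₁)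
        ≡⟨ arithmetic l W₁ T ⟩
      1 + 15 * (suc (l + W₁) + T) ∎
      where
      open ℕₚ.≤-Reasoning
      d′ = value (propagate rows S (value (traverse rows u)) d)
      l = length (row u)
      W₁ = total weight (targets (tour n u u))
      T = totalVisited us
      arithmetic : ∀ l W T → suc (3 * suc (l + W) + (1 + 10 * W + (1 + 15 * T))) + (10 + 12 * l + 2 * W)
                   ≡ 1 + 15 * (suc (l + W) + T)
      arithmetic = solve-∀

    module _ {U : Subset n} (single : ∀ {v w} → v ∈ U → w ∈ U → Connected F v w → v ≡ w) where

      private
        D : Vect n
        D = Dᵁ-entry F M U

      -- Every remaining root must already hold its correct value. Initially that is 1, the entry of
      -- D at a root, and propagation from other roots preserves it.
      propagateFrom-good : ∀ us d → (∀ {u} → u ∈ˡ us → u ∈ U × Good D d u) →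
        ∀ {w} → Good D d w ⊎ Reached us w → Good D (value (propagateFrom rows S us d)) w
      propagateFrom-good []       d _    (inj₁ good) = good
      propagateFrom-good (u ∷ us) d good {w} w-ok =
        propagateFrom-good us d′
          (λ v∈ → proj₁ (good (there v∈)) , keep (inj₁ (proj₂ (good (there v∈))))) (w-ok′ w-ok)
        where
        d′ = value (propagate rows S (value (traverse rows u)) d)

        u∈U : u ∈ U
        u∈U = proj₁ (good (here ≡.refl))

        keep : ∀ {w} → Good D d w ⊎ w ∈ˡ targets (tour n u u) → Good D d′ w
        keep rewrite traverse-value u = propagate-good D {C = Connected F u}
          (λ p e → p ++ʷ (e ∷ [])) (Dᵁ-step U single u∈U) d (tour-ordered n u u {u ∷ []} (here ≡.refl))
          λ { (here ≡.refl) → [] , proj₂ (good (here ≡.refl)) }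

        arrive : ∀ {w} → w ∈ˡ visited u → Good D d′ w
        arrive (here ≡.refl) = keep (inj₁ (proj₂ (good (here ≡.refl))))
        arrive (there w∈)    = keep (inj₂ w∈)

        w-ok′ : Good D d w ⊎ Reached (u ∷ us) w → Good D d′ w ⊎ Reached us w
        w-ok′ (inj₁ good-w)          = inj₁ (keep (inj₁ good-w))
        w-ok′ (inj₂ (here u→w))      = inj₁ (arrive (Equivalence.from (visited⇔connected u _) u→w))
        w-ok′ (inj₂ (there reached)) = inj₂ reached

      -- A vertex that no root reaches keeps its initial 1, which is its entry of D since all
      -- factors of the product are 1 there.
      inverseDiagonal-value : ∀ us → (∀ {u} → u ∈ U ⇔ u ∈ˡ us) →
        ∀ w → Vec.lookup (value (inverseDiagonal rows S us)) w ≈ D w ⁻¹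
      inverseDiagonal-value us U⇔us w
        rewrite mapArray-value (invert {n}) (value (propagateFrom rows S us (Vec.replicate n 1#)))
              | Vecₚ.lookup-map w _⁻¹ (value (propagateFrom rows S us (Vec.replicate n 1#))) =
        sym (⁻¹-cong (Dᵁ-nonzero U single w) (sym (propagateFrom-good us ones roots-good
          (w-ok (Any.any? (λ u → connected? forest u w) us)))))
        where
        ones = Vec.replicate n 1#

        ones-good : ∀ {w} → D w ≈ 1# → Good D ones w
        ones-good {w} Dw≈1 = trans (reflexive (Vecₚ.lookup-replicate w 1#)) (sym Dw≈1)

        roots-good : ∀ {u} → u ∈ˡ us → u ∈ U × Good D ones u
        roots-good u∈us =
          Equivalence.from U⇔us u∈us , ones-good (Dᵁ-root U single (Equivalence.from U⇔us u∈us))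

        w-ok : Dec (Reached us w) → Good D ones w ⊎ Reached us w
        w-ok (yes reached) = inj₂ reached
        w-ok (no ¬reached) = inj₁ (ones-good (Dᵁ-off U single λ u∈U u→w →
          ¬reached (lose (Equivalence.to U⇔us u∈U) u→w)))

    inverseDiagonal-time : ∀ us → time (inverseDiagonal rows S us) ≤ 3 * n + 2 + 15 * totalVisited us
    inverseDiagonal-time us = begin
      n + (time (propagateFrom rows S us ones) + time (mapArray (invert {n}) d))
        ≡⟨ ≡.cong (λ z → n + (time (propagateFrom rows S us ones) + z)) invert-time ⟩
      n + (time (propagateFrom rows S us ones) + (1 + 2 * n))
        ≤⟨ ℕₚ.+-monoʳ-≤ n (ℕₚ.+-monoˡ-≤ (1 + 2 * n) (propagateFrom-time us ones)) ⟩
      n + (1 + 15 * totalVisited us + (1 + 2 * n))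
        ≡⟨ arithmetic n (totalVisited us) ⟩
      3 * n + 2 + 15 * totalVisited us ∎
      where
      open ℕₚ.≤-Reasoning
      ones = Vec.replicate n 1#
      d = value (propagateFrom rows S us ones)

      invert-time : time (mapArray (invert {n}) d) ≡ 1 + 2 * n
      invert-time = ≡.trans (mapArray-time (invert {n}) d)
        (≡.cong suc (≡.trans (total-const 2 (allFin n)) (≡.cong (2 *_) {y = n} (length-tabulate {n = n} id))))

      arithmetic : ∀ n T → n + (1 + 15 * T + (1 + 2 * n)) ≡ 3 * n + 2 + 15 * T
      arithmetic = solve-∀

  module _ (e : Vec Carrier n) where

    rescaleEntry : Fin n × Carrier → Fin n × Carrier
    rescaleEntry (u , a) = u , Vec.lookup e u · a

    rescaleVector : SparseVect n → SparseVect n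
    rescaleVector = map rescaleEntry

    rescale-value : ∀ B → value (rescale e B) ≡ map rescaleVector B
    rescale-value []      = ≡.refl
    rescale-value (s ∷ B) = ≡.cong₂ _∷_ (mapList-value _ s) (rescale-value B)

    rescaleVector-⟦⟧ : ∀ s u → ⟦ rescaleVector s ⟧ u ≈ Vec.lookup e u · ⟦ s ⟧ u
    rescaleVector-⟦⟧ []            u = sym (zeroʳ _)
    rescaleVector-⟦⟧ ((w , a) ∷ s) u with w ≟ u
    ... | yes ≡.refl = refl
    ... | no _       = rescaleVector-⟦⟧ s u

    rescaleVector-reduced : (∀ u → ¬ (Vec.lookup e u ≈ 0#)) →
                            ∀ {s} → IsReduced s → IsReduced (rescaleVector s)
    rescaleVector-reduced e≉0 {s} (uniq , nonzero) =
      ≡.subst Unique (map-∘ s) uniq , All-map⁺ (All.map (*-nonzero (e≉0 _)) nonzero)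

    -- Each entry costs three steps, and the two extra steps per vector are charged to an entry of
    -- it.
    rescale-time : ∀ {B} → All (λ s → 1 ≤ length s) B → time (rescale e B) ≤ 1 + 5 * total length B
    rescale-time []                      = s≤s z≤n
    rescale-time {s ∷ B} (1≤s ∷ nonempty) = begin
      suc (time (mapList entry s) + (time (rescale e B) + 0))
        ≡⟨ ≡.cong (λ z → suc (z + (time (rescale e B) + 0)))
             (≡.trans (mapList-time entry s) (≡.cong suc (total-const 3 s))) ⟩
      suc (1 + 3 * length s + (time (rescale e B) + 0))
        ≤⟨ s≤s (ℕₚ.+-monoʳ-≤ (1 + 3 * length s) (ℕₚ.+-monoˡ-≤ 0 (rescale-time nonempty))) ⟩
      suc (1 + 3 * length s + (1 + 5 * total length B + 0))
        ≡⟨ arithmetic (length s) (total length B) ⟩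
      3 * length s + 2 * 1 + (1 + 5 * total length B)
        ≤⟨ ℕₚ.+-monoˡ-≤ _ (ℕₚ.+-monoʳ-≤ (3 * length s) (ℕₚ.*-monoʳ-≤ 2 1≤s)) ⟩
      3 * length s + 2 * length s + (1 + 5 * total length B)
        ≡⟨ arithmetic′ (length s) (total length B) ⟩
      1 + 5 * (length s + total length B) ∎
      where
      open ℕₚ.≤-Reasoning

      entry : Fin n × Carrier → Timed (Fin n × Carrier)
      entry (u , a) = do
        eᵤ ← e ! u
        x  ← multiply {n} eᵤ a
        return (u , x)

      arithmetic : ∀ l T → suc (1 + 3 * l + (1 + 5 * T + 0)) ≡ 3 * l + 2 * 1 + (1 + 5 * T)
      arithmetic = solve-∀

      arithmetic′ : ∀ l T → 3 * l + 2 * l + (1 + 5 * T) ≡ 1 + 5 * (l + T)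
      arithmetic′ = solve-∀

  module _ {c₀ : ℕ} (known : ForestAlgorithms c₀) where
    open ForestAlgorithms known

    open MeetsSpec (meetsSpec F forest adjacency adjacency-correct)
    open Roots components-roots using (roots; listed; covering; duration)

    private
      B_F : List (SparseVect n)
      B_F = value (findBasis adjacency)

      S : Subset n
      S = value (findSupp adjacency)

      us : List (Fin n)
      us = value (choose S (map visited roots))

      U : Subset n
      U = fromList us

      e : Vec Carrier n
      e = value (inverseDiagonal rows S us)

      choice : Choice S roots us
      choice = choose-choice S (Roots.spread components-roots)

      U-choice : IsChoice F U
      U-choice = choice-correct S supp-correct reachable choice
        where
        reachable : ∀ w → Reached roots w
        reachable w with covering (∈-allFin w)
        ... | inj₁ seen = contradiction (≡.trans (≡.sym (Vecₚ.lookup-replicate w false)) seen) λ ()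
        ... | inj₂ r    = r

      single : ∀ {v w} → v ∈ U → w ∈ U → Connected F v w → v ≡ w
      single = IsChoice.single U-choice

      e≈ : ∀ w → Vec.lookup e w ≈ Dᵁ-entry F M U w ⁻¹
      e≈ = inverseDiagonal-value S supp-correct single us ∈-fromList

      procedure-value : value (procedure known rows) ≡ map (rescaleVector e) B_F
      procedure-value = ≡.trans
        (≡.cong (λ Ts → value (rescale (value (inverseDiagonal rows S (value (choose S Ts)))) B_F)) listed)
        (rescale-value e B_F)

      rescaled : Pointwise (λ b_M b_F → ∀ u → ⟦ b_M ⟧ u ≈ Dᵁ-entry F M U u ⁻¹ · ⟦ b_F ⟧ u)
                           (map (rescaleVector e) B_F) B_F
      rescaled = go B_F
        where
        go : ∀ B → Pointwise (λ b_M b_F → ∀ u → ⟦ b_M ⟧ u ≈ Dᵁ-entry F M U u ⁻¹ · ⟦ b_F ⟧ u)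
                             (map (rescaleVector e) B) B
        go []      = []
        go (s ∷ B) = (λ u → trans (rescaleVector-⟦⟧ e s u) (*-congʳ (e≈ u))) ∷ go B

    procedure-reduced : All IsReduced (value (procedure known rows))
    procedure-reduced rewrite procedure-value = All-map⁺ (All.map
      (rescaleVector-reduced e λ u → ⁻¹-nonzero (Dᵁ-nonzero U single u) ∘ trans (sym (e≈ u))) basis-reduced)

    procedure-scaling : ∃ λ (U : Subset n) → IsChoice F U ×
      Pointwise (λ b_M b_F → ∀ u → ⟦ b_M ⟧ u ≈ (Dᵁ⁻¹ F M U *ᵥ ⟦ b_F ⟧) u) (value (procedure known rows)) B_F
    procedure-scaling rewrite procedure-value = U , U-choice , Pointwise.map
      (λ b≈ u → trans (b≈ u) (sym (diag-*ᵥ (λ w → Dᵁ-entry F M U w ⁻¹) _ u))) rescaled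

    procedure-sparsest : IsSparsestBasis (Null M) ⟦ value (procedure known rows) ⟧*
    procedure-sparsest rewrite procedure-value = Dᵁ⁻¹-sparsest U-choice
      (basis-reindex (Pointwise.Pointwise-length rescaled) basis-sparsest)
      -- `Pointwise.lookup⁺` matches indices by a cast, `basis-reindex` by `≡.subst`.
      λ i u → ≡.subst (λ j → ⟦ map (rescaleVector e) B_F ⟧* i u ≈ Dᵁ-entry F M U u ⁻¹ · ⟦ B_F ⟧* j u)
        (≡.sym (subst-is-cast (Pointwise.Pointwise-length rescaled) i)) (Pointwise.lookup⁺ rescaled i u)

    private
      nnz-B_F : nnzFamily ⟦ B_F ⟧* ≡ total length B_F
      nnz-B_F = nnzFamily-reduced basis-reduced

      nnz-B_M : nnzFamily ⟦ value (procedure known rows) ⟧* ≡ total length B_F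
      nnz-B_M = ≡.trans (nnzFamily-reduced procedure-reduced)
        (≡.trans (≡.cong (total length) procedure-value) (go B_F))
        where
        go : ∀ B → total length (map (rescaleVector e) B) ≡ total length B
        go []      = ≡.refl
        go (s ∷ B) = ≡.cong₂ ℕ._+_ (length-map (rescaleEntry e) s) (go B)

      nonempty : All (λ s → 1 ≤ length s) B_F
      nonempty = All.tabulate λ {s} s∈ → positive s s∈
        where
        positive : ∀ s → s ∈ˡ B_F → 1 ≤ length s
        positive (_ ∷ _) _ = s≤s z≤n
        positive []      ∅∈ = contradiction
          (λ u → reflexive (≡.cong (λ s → ⟦ s ⟧ u) (≡.sym (Anyₚ.lookup-index ∅∈))))
          (basis-nonzero (proj₁ basis-sparsest) (Any.index ∅∈))

    -- Rescaling preserves the number of nonzero entries, so the time for finding the basis of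
    -- Null(A(F)) is bounded by the size of the output. The two known algorithms account for 2 * c₀.
    -- Of the rest, the total weight enters 2 + 7 + 4 + 15 = 28 times and the loops over all indices
    -- add 7 * n, so the largest coefficient is 35, rounded up to 40.
    procedure-time : time (procedure known rows) ≤
      (2 * c₀ + 40) * (1 + n + nnzFamily M + nnzFamily ⟦ value (procedure known rows) ⟧*)
    procedure-time rewrite nnz-B_M = begin
      time (findForest rows) + (time (findBasis adjacency) + (time (findSupp adjacency) +
        (n + (n + time components′) + rest (value components′))))
        ≡⟨ ≡.cong (λ Ts → time (findForest rows) + (time (findBasis adjacency) + (time (findSupp adjacency) +
             (n + (n + time components′) + rest Ts)))) listed ⟩
      time (findForest rows) + (time (findBasis adjacency) + (time (findSupp adjacency) +
        (n + (n + time components′) + (time (choose S (map visited roots)) +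
          (time (inverseDiagonal rows S us) + time (rescale e B_F))))))
        ≤⟨ ℕₚ.+-mono-≤ findForest-time (ℕₚ.+-mono-≤ basis-time (ℕₚ.+-mono-≤ supp-time (ℕₚ.+-mono-≤
             (ℕₚ.+-monoʳ-≤ n (ℕₚ.+-monoʳ-≤ n components-time))
             (ℕₚ.+-mono-≤ choose-time′ (ℕₚ.+-mono-≤ inverse-time (rescale-time e nonempty)))))) ⟩
      1 + 2 * W + (c₀ * (1 + n + nnzFamily ⟦ B_F ⟧*) + (c₀ * (1 + n) +
        (n + (n + (1 + 2 * n + 7 * W)) + (1 + 4 * W +
          (3 * n + 2 + 15 * W + (1 + 5 * b))))))
        ≡⟨ ≡.cong₂ (λ W b′ → bound W b′) totalWeight nnz-B_F ⟩
      bound (n + nnzFamily M) b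
        ≤⟨ ℕₚ.m≤m+n _ _ ⟩
      bound (n + nnzFamily M) b +
        -- The slack is the exact difference between the two sides, which turns the inequality into
        -- a ring identity.
        (c₀ * (2 * nnzFamily M + b) + 34 + 5 * n + 12 * nnzFamily M + 35 * b)
        ≡⟨ arithmetic c₀ n (nnzFamily M) b ⟩
      (2 * c₀ + 40) * (1 + n + nnzFamily M + b) ∎
      where
      open ℕₚ.≤-Reasoning
      components′ = componentsFrom rows (allFin n) (Vec.replicate n false)
      W = total weight (allFin n)
      b = total length B_F

      rest : List (List (Fin n)) → ℕ
      rest Ts = time (choose S Ts) + (time (inverseDiagonal rows S (value (choose S Ts))) +
        time (rescale (value (inverseDiagonal rows S (value (choose S Ts)))) B_F))

      roots-bound : totalVisited roots ≤ W
      roots-bound = totalVisited-bound (Roots.spread components-roots)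

      components-time : time components′ ≤ 1 + 2 * n + 7 * W
      components-time = ℕₚ.≤-trans duration (s≤s (ℕₚ.+-mono-≤
        (ℕₚ.≤-reflexive (≡.cong (2 *_) {y = n} (length-tabulate {n = n} id))) (ℕₚ.*-monoʳ-≤ 7 roots-bound)))

      choose-time′ : time (choose S (map visited roots)) ≤ 1 + 4 * W
      choose-time′ = ℕₚ.≤-trans (choose-time S roots) (s≤s (ℕₚ.*-monoʳ-≤ 4 roots-bound))

      inverse-time : time (inverseDiagonal rows S us) ≤ 3 * n + 2 + 15 * W
      inverse-time = ℕₚ.≤-trans (inverseDiagonal-time S supp-correct us)
        (ℕₚ.+-monoʳ-≤ (3 * n + 2) (ℕₚ.*-monoʳ-≤ 15 (totalVisited-bound (Choice.spread choice))))

      bound : ℕ → ℕ → ℕ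
      bound W b′ = 1 + 2 * W + (c₀ * (1 + n + b′) + (c₀ * (1 + n) +
        (n + (n + (1 + 2 * n + 7 * W)) + (1 + 4 * W +
          (3 * n + 2 + 15 * W + (1 + 5 * b))))))

      arithmetic : ∀ c₀ n m b →
        1 + 2 * (n + m) + (c₀ * (1 + n + b) + (c₀ * (1 + n) +
          (n + (n + (1 + 2 * n + 7 * (n + m))) + (1 + 4 * (n + m) +
            (3 * n + 2 + 15 * (n + m) + (1 + 5 * b)))))) +
        (c₀ * (2 * m + b) + 34 + 5 * n + 12 * m + 35 * b)
        ≡ (2 * c₀ + 40) * (1 + n + m + b)
      arithmetic = solve-∀

open import Defs
open import Data.Nat using (_+_; _*_)

mainTheorem3 :
  ∀ c ℓ (c₀ : ℕ) → ∃ λ (C : ℕ) →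
  ∀ (K : Field c ℓ) {n} (M : Matrix K n) (F : Graph n) → IsForest F → _∈𝓜₀_ K M F →
    (∀ {k} (B_F : Fin k → Vect K n) (U : Subset n) →
      IsSparsestBasis K (Null K (A K F)) B_F → IsChoice K F U →
        IsInverse K (Dᵁ⁻¹ K F M U) (Dᵁ K F M U)
      × IsSparsestBasis K (Null K M) (λ i → _*ᵥ_ K (Dᵁ⁻¹ K F M U) (B_F i)))
  × (∀ (known : ForestAlgorithms K c₀) (rows : SparseMatrix K n) → IsSparseFormOf K rows M →
      let adj = value (findForest K rows)
          B_F = value (ForestAlgorithms.findBasis known adj)
          B_M = value (procedure K known rows)
      in  IsAdjacencyListsOf adj F
        × (∃ λ (U : Subset n) → IsChoice K F U ×
            Pointwise (λ b_M b_F → ∀ u → Field._≈_ K (⟦_⟧ K b_M u) (_*ᵥ_ K (Dᵁ⁻¹ K F M U) (⟦_⟧ K b_F) u)) B_M B_F)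
        × All (IsReduced K) B_M
        × IsSparsestBasis K (Null K M) (⟦_⟧* K B_M)
        × time (procedure K known rows) ≤ C * (1 + n + nnzFamily K M + nnzFamily K (⟦_⟧* K B_M)))
mainTheorem3 c ℓ c₀ = 2 * c₀ + 40 , λ K M F forest M∈ →
    (λ B_F U sparsest choice →
        Diagonal.Dᵁ⁻¹-inverse K F forest M M∈ U (IsChoice.single choice)
      , Diagonal.Dᵁ⁻¹-sparsest K F forest M M∈ choice sparsest λ i → LinearProperties.diag-*ᵥ K _ (B_F i))
  , λ known rows form → let open Procedure K F forest M M∈ rows form in
        adjacency-correct
      , procedure-scaling known
      , procedure-reduced known
      , procedure-sparsest known
      , procedure-time known
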